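{- Let $f$ be a formula with $m$ clauses over $n$ variables, each clause being a CNF, cardinality, XOR or NAE constraint, and let $F=\sum_c\mathrm{FE}_c$, a multilinear polynomial on $[-1,1]^n$ with values in $[-m,m]$. Run projected gradient descent with step size $\eta=\frac{1}{nm}$ from any starting point $x_0\in[-1,1]^n$: $$x_{t+1}=\Pi_{[-1,1]^n}\big(x_t-\eta\nabla F(x_t)\big)=x_t-\eta G(x_t).$$ Then within $O\big(\frac{nm^2}{\epsilon^2}\big)$ iterations it reaches an $\epsilon$-projected-critical point, i.e. an iterate $x_t$ with $\|G(x_t)\|_2<\epsilon$.
   Context: Boolean values are encoded as $\pm1$, with $-1$ standing for True. $\mathrm{FE}_c$ is the Fourier expansion of clause $c$, i.e. the unique multilinear polynomial agreeing with $c$ (as a $\{\pm1\}$-valued function) on $\{\pm1\}^n$. $\Pi_{[-1,1]^n}(y)=\arg\min_{x\in[-1,1]^n}\tfrac12\|x-y\|_2^2$ is the Euclidean projection onto the cube. The gradient mapping is $G(x)=\frac1\eta\big(x-\Pi_{[-1,1]^n}(x-\eta\nabla F(x))\big)$. -}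

module Defs where

open import Algebra.Bundles using (CommutativeRing)
import Algebra.Definitions.RawMonoid as RawMonoidDefinitions
import Algebra.Properties.Semiring.Sum as SemiringSum
import Algebra.Properties.Ring as RingProperties
import Algebra.Properties.AbelianGroup as AbelianGroupProperties
import Algebra.Properties.Semiring.Mult.TCOptimised as Mult
import Algebra.Solver.Ring as RingSolver
open import Algebra.Solver.Ring.AlmostCommutativeRing
  using (fromCommutativeRing; _-Raw-AlmostCommutative⟶_)
open import Data.Bool.ListAction using (any)
open import Data.Bool.Base using (Bool; true; false; not; _∧_; _xor_; if_then_else_)
open import Data.Empty using (⊥-elim)
open import Data.Fin.Base using (Fin; zero; suc)
open import Data.Fin.Subset using (Subset; inside; outside)
open import Data.Integer.Base as ℤ using (ℤ; -[1+_]; _⊖_)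
import Data.Integer.Properties as ℤ
open import Data.List.Base using (List; map; foldr; filterᵇ; length)
open import Data.Nat.Base as ℕ using (ℕ; zero; suc; _≤ᵇ_; _≡ᵇ_)
open import Data.Product using (∃; ∃!; _×_; _,_; proj₁; proj₂)
open import Data.Sum.Base using (inj₁; inj₂)
open import Data.Vec.Base using (Vec; []; _∷_; lookup; _[_]≔_)
open import Data.Vec.Functional using (Vector; head; tail)
import Data.Vec.Functional.Relation.Binary.Equality.Setoid as VectorEquality
open import Function.Base using (_∘_; _$_)
open import Level using (0ℓ)
open import Relation.Binary.Bundles using (DecTotalOrder)
open import Relation.Binary.Core using (Rel)
open import Relation.Binary.Definitions using (WeaklyDecidable)
import Relation.Binary.Properties.DecTotalOrder as DecTotalOrderProperties
import Relation.Binary.Reasoning.PartialOrder as ≤-Reasoning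
open import Relation.Binary.PropositionalEquality.Core as ≡ using (_≡_)
open import Relation.Binary.Structures using (IsDecTotalOrder)
open import Relation.Nullary.Decidable.Core using (yes; no; dec⇒maybe)
open import Relation.Nullary.Negation.Core using (¬_)
open import Relation.Unary using (Pred; Satisfiable)
open import Data.Maybe.Base as Maybe using (Maybe)

-- The reals, axiomatised as a Dedekind-complete ordered field.  As in
-- classical analysis the order is decidable, and _⁻¹ is total with an
-- unspecified value at 0#.  The Archimedean property follows classically
-- from `sup`; it is a separate field because extracting the natural
-- number from a completeness argument is not constructive.

record Reals : Set₁ where
  field
    commutativeRing : CommutativeRing 0ℓ 0ℓ

  open CommutativeRing commutativeRing public
    hiding (zero) renaming (Carrier to ℝ)
  open RawMonoidDefinitions +-rawMonoid public
    using () renaming (_×_ to infixr 8 _·_)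

  fromℕ : ℕ → ℝ
  fromℕ k = k · 1#

  infix 4 _≤_
  infix 9 _⁻¹

  field
    _≤_             : Rel ℝ 0ℓ
    isDecTotalOrder : IsDecTotalOrder _≈_ _≤_
    +-monoʳ-≤       : ∀ x {y z} → y ≤ z → x + y ≤ x + z
    *-nonneg        : ∀ {x y} → 0# ≤ x → 0# ≤ y → 0# ≤ x * y

    _⁻¹             : ℝ → ℝ
    ⁻¹-cong         : ∀ {x y} → x ≈ y → x ⁻¹ ≈ y ⁻¹
    *-inverseʳ      : ∀ {x} → x ≉ 0# → x * x ⁻¹ ≈ 1#
    1≉0             : 1# ≉ 0#

  UpperBound : Pred ℝ 0ℓ → Pred ℝ 0ℓ
  UpperBound P b = ∀ {x} → P x → x ≤ b

  field
    archimedean : ∀ x → ∃ λ k → x ≤ fromℕ k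
    sup         : ∀ (P : Pred ℝ 0ℓ) → Satisfiable P → Satisfiable (UpperBound P) →
                  ∃ λ s → UpperBound P s × (∀ {b} → UpperBound P b → s ≤ b)

  decTotalOrder : DecTotalOrder 0ℓ 0ℓ 0ℓ
  decTotalOrder = record { isDecTotalOrder = isDecTotalOrder }

  open DecTotalOrder decTotalOrder public
    using (_≤?_; total; antisym; poset)
    renaming (refl to ≤-refl; reflexive to ≤-reflexive; trans to ≤-trans)

  open DecTotalOrderProperties decTotalOrder public
    using (_<_; ≰⇒>)

  infixl 7 _/_

  _/_ : ℝ → ℝ → ℝ
  x / y = x * y ⁻¹

  ½ : ℝ
  ½ = 1# / fromℕ 2

module RealProperties (R : Reals) where

  open Reals R
  open RingProperties ring using (-0#≈0#; -‿distribʳ-*; -‿involutive)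
    renaming (x∙y⁻¹≈ε⇒x≈y to x-y≈0⇒x≈y)
  open AbelianGroupProperties +-abelianGroup using (⁻¹-∙-comm)
  open ≤-Reasoning poset

  private
    open Mult semiring renaming (_×_ to _·′_)

    ⟦_⟧ℤ : ℤ → ℝ
    ⟦ ℤ.+ n    ⟧ℤ = n ·′ 1#
    ⟦ -[1+ n ] ⟧ℤ = - (suc n ·′ 1#)

    ⊖-homo : ∀ m n → ⟦ m ⊖ n ⟧ℤ ≈ m ·′ 1# - n ·′ 1#
    ⊖-homo m zero = begin-equality
      m ·′ 1#       ≈⟨ +-identityʳ _ ⟨
      m ·′ 1# + 0#  ≈⟨ +-congˡ -0#≈0# ⟨
      m ·′ 1# - 0#  ∎
    ⊖-homo zero (suc n) = sym (+-identityˡ _)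
    ⊖-homo (suc m) (suc n) = begin-equality
      ⟦ suc m ⊖ suc n ⟧ℤ                  ≡⟨ ≡.cong ⟦_⟧ℤ (ℤ.[1+m]⊖[1+n]≡m⊖n m n) ⟩
      ⟦ m ⊖ n ⟧ℤ                          ≈⟨ ⊖-homo m n ⟩
      m ·′ 1# - n ·′ 1#                     ≈⟨ +-congˡ (+-identityˡ _) ⟨
      m ·′ 1# + (0# - n ·′ 1#)              ≈⟨ +-congˡ (+-congʳ (-‿inverseʳ 1#)) ⟨
      m ·′ 1# + ((1# - 1#) - n ·′ 1#)       ≈⟨ +-congˡ (+-assoc _ _ _) ⟩
      m ·′ 1# + (1# + (- 1# - n ·′ 1#))     ≈⟨ +-assoc _ _ _ ⟨
      (m ·′ 1# + 1#) + (- 1# - n ·′ 1#)     ≈⟨ +-cong (+-comm _ _) (⁻¹-∙-comm _ _) ⟩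
      (1# + m ·′ 1#) - (1# + n ·′ 1#)       ≈⟨ +-cong (1+× m 1#) (-‿cong (1+× n 1#)) ⟨
      suc m ·′ 1# - suc n ·′ 1#             ∎

    +-homo : ∀ i j → ⟦ i ℤ.+ j ⟧ℤ ≈ ⟦ i ⟧ℤ + ⟦ j ⟧ℤ
    +-homo (ℤ.+ m)  (ℤ.+ n)  = ×-homo-+ 1# m n
    +-homo (ℤ.+ m)  -[1+ n ] = ⊖-homo m (suc n)
    +-homo -[1+ m ] (ℤ.+ n)  = trans (⊖-homo n (suc m)) (+-comm _ _)
    +-homo -[1+ m ] -[1+ n ] = begin-equality
      - (suc (suc (m ℕ.+ n)) ·′ 1#)        ≈⟨ -‿cong (1+× (suc (m ℕ.+ n)) 1#) ⟩
      - (1# + suc (m ℕ.+ n) ·′ 1#)         ≈⟨ -‿cong (+-congˡ (×-homo-+ 1# (suc m) n)) ⟩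
      - (1# + (suc m ·′ 1# + n ·′ 1#))      ≈⟨ -‿cong (+-assoc _ _ _) ⟨
      - ((1# + suc m ·′ 1#) + n ·′ 1#)      ≈⟨ -‿cong (+-congʳ (+-comm _ _)) ⟩
      - ((suc m ·′ 1# + 1#) + n ·′ 1#)      ≈⟨ -‿cong (+-assoc _ _ _) ⟩
      - (suc m ·′ 1# + (1# + n ·′ 1#))      ≈⟨ -‿cong (+-congˡ (1+× n 1#)) ⟨
      - (suc m ·′ 1# + suc n ·′ 1#)         ≈⟨ ⁻¹-∙-comm _ _ ⟨
      - (suc m ·′ 1#) - suc n ·′ 1#         ∎

    -‿homo : ∀ i → ⟦ ℤ.- i ⟧ℤ ≈ - ⟦ i ⟧ℤ
    -‿homo (ℤ.+ zero)  = sym -0#≈0#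
    -‿homo (ℤ.+ suc n) = refl
    -‿homo -[1+ n ]    = sym (-‿involutive _)

    *-homo⁺ : ∀ m j → ⟦ ℤ.+ m ℤ.* j ⟧ℤ ≈ m ·′ 1# * ⟦ j ⟧ℤ
    *-homo⁺ m (ℤ.+ n) = begin-equality
      ⟦ ℤ.+ m ℤ.* ℤ.+ n ⟧ℤ    ≡⟨ ≡.cong ⟦_⟧ℤ (ℤ.pos-* m n) ⟨
      (m ℕ.* n) ·′ 1#          ≈⟨ ×1-homo-* m n ⟩
      m ·′ 1# * (n ·′ 1#)       ∎
    *-homo⁺ m -[1+ n ] = begin-equality
      ⟦ ℤ.+ m ℤ.* -[1+ n ] ⟧ℤ              ≡⟨ ≡.cong ⟦_⟧ℤ (ℤ.neg-distribʳ-* (ℤ.+ m) (ℤ.+ suc n)) ⟨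
      ⟦ ℤ.- (ℤ.+ m ℤ.* ℤ.+ suc n) ⟧ℤ       ≈⟨ -‿homo (ℤ.+ m ℤ.* ℤ.+ suc n) ⟩
      - ⟦ ℤ.+ m ℤ.* ℤ.+ suc n ⟧ℤ           ≈⟨ -‿cong (*-homo⁺ m (ℤ.+ suc n)) ⟩
      - (m ·′ 1# * (suc n ·′ 1#))            ≈⟨ -‿distribʳ-* _ _ ⟩
      m ·′ 1# * - (suc n ·′ 1#)              ∎

    *-homo : ∀ i j → ⟦ i ℤ.* j ⟧ℤ ≈ ⟦ i ⟧ℤ * ⟦ j ⟧ℤ
    *-homo (ℤ.+ m)  j = *-homo⁺ m j
    *-homo -[1+ m ] j = begin-equality
      ⟦ -[1+ m ] ℤ.* j ⟧ℤ          ≡⟨ ≡.cong ⟦_⟧ℤ (ℤ.neg-distribˡ-* (ℤ.+ suc m) j) ⟨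
      ⟦ ℤ.- (ℤ.+ suc m ℤ.* j) ⟧ℤ   ≈⟨ -‿homo (ℤ.+ suc m ℤ.* j) ⟩
      - ⟦ ℤ.+ suc m ℤ.* j ⟧ℤ       ≈⟨ -‿cong (*-homo⁺ (suc m) j) ⟩
      - (suc m ·′ 1# * ⟦ j ⟧ℤ)      ≈⟨ RingProperties.-‿distribˡ-* ring _ _ ⟩
      - (suc m ·′ 1#) * ⟦ j ⟧ℤ      ∎

    morphism : ℤ.+-*-rawRing -Raw-AlmostCommutative⟶ fromCommutativeRing commutativeRing
    morphism = record
      { ⟦_⟧    = ⟦_⟧ℤ
      ; +-homo = +-homo
      ; *-homo = *-homo
      ; -‿homo = -‿homo
      ; 0-homo = refl
      ; 1-homo = refl
      }

    _coeff≟_ : WeaklyDecidable (λ i j → ⟦ i ⟧ℤ ≈ ⟦ j ⟧ℤ)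
    i coeff≟ j = Maybe.map (λ eq → reflexive (≡.cong ⟦_⟧ℤ eq)) (dec⇒maybe (i ℤ.≟ j))

  module Solver = RingSolver ℤ.+-*-rawRing (fromCommutativeRing commutativeRing) morphism _coeff≟_

  open Solver using (solve; _:=_; _:+_; _:*_; _:-_; :-_; con)

  x≤y⇒0≤y-x : ∀ {x y} → x ≤ y → 0# ≤ y - x
  x≤y⇒0≤y-x {x} {y} x≤y = begin
    0#       ≈⟨ -‿inverseˡ x ⟨
    - x + x  ≤⟨ +-monoʳ-≤ (- x) x≤y ⟩
    - x + y  ≈⟨ +-comm _ _ ⟩
    y - x    ∎

  0≤y-x⇒x≤y : ∀ {x y} → 0# ≤ y - x → x ≤ y
  0≤y-x⇒x≤y {x} {y} 0≤y-x = begin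
    x            ≈⟨ +-identityʳ x ⟨
    x + 0#       ≤⟨ +-monoʳ-≤ x 0≤y-x ⟩
    x + (y - x)  ≈⟨ solve 2 (λ x y → x :+ (y :- x) := y) refl x y ⟩
    y            ∎

  +-mono-≤ : ∀ {x y u v} → x ≤ y → u ≤ v → x + u ≤ y + v
  +-mono-≤ {x} {y} {u} {v} x≤y u≤v = begin
    x + u  ≤⟨ +-monoʳ-≤ x u≤v ⟩
    x + v  ≈⟨ +-comm _ _ ⟩
    v + x  ≤⟨ +-monoʳ-≤ v x≤y ⟩
    v + y  ≈⟨ +-comm _ _ ⟩
    y + v  ∎

  +-nonneg : ∀ {x y} → 0# ≤ x → 0# ≤ y → 0# ≤ x + y
  +-nonneg 0≤x 0≤y = ≤-trans (≤-reflexive (sym (+-identityˡ 0#))) (+-mono-≤ 0≤x 0≤y)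

  *-monoʳ-≤ : ∀ {x y z} → 0# ≤ x → y ≤ z → x * y ≤ x * z
  *-monoʳ-≤ {x} {y} {z} 0≤x y≤z = 0≤y-x⇒x≤y $ begin
    0#             ≤⟨ *-nonneg 0≤x (x≤y⇒0≤y-x y≤z) ⟩
    x * (z - y)    ≈⟨ solve 3 (λ x y z → x :* (z :- y) := x :* z :- x :* y) refl x y z ⟩
    x * z - x * y  ∎

  *-mono-≤ : ∀ {x y u v} → 0# ≤ x → x ≤ y → 0# ≤ u → u ≤ v → x * u ≤ y * v
  *-mono-≤ {x} {y} {u} {v} 0≤x x≤y 0≤u u≤v = begin
    x * u  ≤⟨ *-monoʳ-≤ 0≤x u≤v ⟩
    x * v  ≈⟨ *-comm _ _ ⟩
    v * x  ≤⟨ *-monoʳ-≤ (≤-trans 0≤u u≤v) x≤y ⟩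
    v * y  ≈⟨ *-comm _ _ ⟩
    y * v  ∎

  0≤x*x : ∀ x → 0# ≤ x * x
  0≤x*x x with total 0# x
  ... | inj₁ 0≤x = *-nonneg 0≤x 0≤x
  ... | inj₂ x≤0 = begin
    0#                     ≤⟨ *-nonneg 0≤-x 0≤-x ⟩
    (0# - x) * (0# - x)    ≈⟨ solve 1 (λ x → (con ℤ.0ℤ :- x) :* (con ℤ.0ℤ :- x) := x :* x) refl x ⟩
    x * x                  ∎
    where 0≤-x = x≤y⇒0≤y-x x≤0

  0≤1 : 0# ≤ 1#
  0≤1 = ≤-trans (0≤x*x 1#) (≤-reflexive (*-identityˡ 1#))

  *-cancelˡ-0 : ∀ {x y} → x ≉ 0# → x * y ≈ 0# → y ≈ 0#
  *-cancelˡ-0 {x} {y} x≉0 xy≈0 = begin-equality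
    y                ≈⟨ *-identityˡ y ⟨
    1# * y           ≈⟨ *-congʳ (*-inverseʳ x≉0) ⟨
    x * x ⁻¹ * y     ≈⟨ solve 3 (λ x y z → x :* z :* y := z :* (x :* y)) refl x y (x ⁻¹) ⟩
    x ⁻¹ * (x * y)   ≈⟨ *-congˡ xy≈0 ⟩
    x ⁻¹ * 0#        ≈⟨ zeroʳ _ ⟩
    0#               ∎

  x*x≈0⇒x≈0 : ∀ {x} → x * x ≈ 0# → x ≈ 0#
  x*x≈0⇒x≈0 {x} xx≈0 with x ≤? 0# | 0# ≤? x
  ... | yes x≤0 | yes 0≤x = antisym x≤0 0≤x
  ... | no  x≰0 | _       = *-cancelˡ-0 (λ x≈0 → x≰0 (≤-reflexive x≈0)) xx≈0
  ... | _       | no  0≰x = *-cancelˡ-0 (λ x≈0 → 0≰x (≤-reflexive (sym x≈0))) xx≈0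

  ⁻¹-nonneg : ∀ {x} → 0# < x → 0# ≤ x ⁻¹
  ⁻¹-nonneg {x} (0≤x , 0≉x) = begin
    0#                  ≤⟨ *-nonneg 0≤x (0≤x*x (x ⁻¹)) ⟩
    x * (x ⁻¹ * x ⁻¹)   ≈⟨ *-assoc _ _ _ ⟨
    x * x ⁻¹ * x ⁻¹     ≈⟨ *-congʳ (*-inverseʳ (0≉x ∘ sym)) ⟩
    1# * x ⁻¹           ≈⟨ *-identityˡ _ ⟩
    x ⁻¹                ∎

  0<x+1 : ∀ {x} → 0# ≤ x → 0# < x + 1#
  0<x+1 {x} 0≤x = +-nonneg 0≤x 0≤1 , λ 0≈x+1 → 1≉0 $ antisym
    (begin
      1#       ≈⟨ +-identityˡ 1# ⟨
      0# + 1#  ≤⟨ +-mono-≤ 0≤x ≤-refl ⟩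
      x + 1#   ≈⟨ 0≈x+1 ⟨
      0#       ∎)
    0≤1

  2≉0 : fromℕ 2 ≉ 0#
  2≉0 2≈0 = proj₂ (0<x+1 0≤1) (trans (sym 2≈0) (+-congˡ (+-identityʳ 1#)))

  ½+½≈1 : ½ + ½ ≈ 1#
  ½+½≈1 = begin-equality
    ½ + ½                      ≈⟨ solve 1 (λ h → con ℤ.1ℤ :* h :+ con ℤ.1ℤ :* h :=
                                                 (con ℤ.1ℤ :+ (con ℤ.1ℤ :+ con ℤ.0ℤ)) :* h) refl (fromℕ 2 ⁻¹) ⟩
    fromℕ 2 * fromℕ 2 ⁻¹       ≈⟨ *-inverseʳ 2≉0 ⟩
    1#                         ∎

  halve : ∀ x → ½ * x + ½ * x ≈ x
  halve x = begin-equality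
    ½ * x + ½ * x  ≈⟨ distribʳ x ½ ½ ⟨
    (½ + ½) * x    ≈⟨ *-congʳ ½+½≈1 ⟩
    1# * x         ≈⟨ *-identityˡ x ⟩
    x              ∎

  0≤½ : 0# ≤ ½
  0≤½ = *-nonneg 0≤1 (⁻¹-nonneg (+-nonneg 0≤1 (+-nonneg 0≤1 ≤-refl) , 2≉0 ∘ sym))

  x+x≈0⇒x≈0 : ∀ {x} → x + x ≈ 0# → x ≈ 0#
  x+x≈0⇒x≈0 {x} x+x≈0 = begin-equality
    x              ≈⟨ halve x ⟨
    ½ * x + ½ * x  ≈⟨ distribˡ ½ x x ⟨
    ½ * (x + x)    ≈⟨ *-congˡ x+x≈0 ⟩
    ½ * 0#         ≈⟨ zeroʳ ½ ⟩
    0#             ∎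

  x*x≤y*y⇒x≤y : ∀ {x y} → 0# ≤ y → x * x ≤ y * y → x ≤ y
  x*x≤y*y⇒x≤y {x} {y} 0≤y xx≤yy with x ≤? y
  ... | yes x≤y = x≤y
  ... | no  x≰y = ≤-reflexive (x-y≈0⇒x≈y x y (x*x≈0⇒x≈0 (antisym [x-y]²≤0 (0≤x*x _))))
    where
    y≤x = proj₁ (≰⇒> x≰y)
    [x-y]²≤0 : (x - y) * (x - y) ≤ 0#
    [x-y]²≤0 = 0≤y-x⇒x≤y $ begin
      0#
        ≤⟨ +-nonneg (x≤y⇒0≤y-x xx≤yy) (+-nonneg yd yd) ⟩
      (y * y - x * x) + (y * (x - y) + y * (x - y))
        ≈⟨ solve 2 (λ x y → (y :* y :- x :* x) :+ (y :* (x :- y) :+ y :* (x :- y)) :=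
                            con ℤ.0ℤ :- (x :- y) :* (x :- y)) refl x y ⟩
      0# - (x - y) * (x - y)
        ∎
      where yd = *-nonneg 0≤y (x≤y⇒0≤y-x y≤x)

  √-construction : ∀ {x} → 0# ≤ x → ∃! _≈_ λ r → 0# ≤ r × r * r ≈ x
  √-construction {x} 0≤x = s , (0≤s , antisym s²≤x x≤s²) , unique
    where
    P : Pred ℝ 0ℓ
    P y = 0# ≤ y × y * y ≤ x

    P0 : P 0#
    P0 = ≤-refl , ≤-trans (≤-reflexive (zeroˡ 0#)) 0≤x

    bounded : UpperBound P (x + 1#)
    bounded {y} (0≤y , yy≤x) = x*x≤y*y⇒x≤y (proj₁ (0<x+1 0≤x)) $ begin
      y * y                    ≤⟨ yy≤x ⟩
      x                        ≤⟨ 0≤y-x⇒x≤y (≤-trans (+-nonneg (+-nonneg (0≤x*x x) 0≤x) 0≤1) (≤-reflexive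
                                   (solve 1 (λ x → x :* x :+ x :+ con ℤ.1ℤ :=
                                     (x :+ con ℤ.1ℤ) :* (x :+ con ℤ.1ℤ) :- x) refl x))) ⟩
      (x + 1#) * (x + 1#)      ∎

    lub = sup P (0# , P0) (x + 1# , bounded)
    s = proj₁ lub

    0≤s : 0# ≤ s
    0≤s = proj₁ (proj₂ lub) P0

    -- If s² < x then s + h with h = (x - s²) / (2s + (x - s²) + 1) is still in P.
    x≤s² : x ≤ s * s
    x≤s² with x ≤? s * s
    ... | yes p = p
    ... | no  x≰s² = ⊥-elim (d≰0 d≤0)
      where
      d e h : ℝ
      d = x - s * s
      e = s + s + d + 1#
      h = d * e ⁻¹

      d≰0 : ¬ (d ≤ 0#)
      d≰0 d≤0 = x≰s² $ 0≤y-x⇒x≤y $ begin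
        0#          ≤⟨ x≤y⇒0≤y-x d≤0 ⟩
        0# - d      ≈⟨ solve 2 (λ x s → con ℤ.0ℤ :- (x :- s) := s :- x) refl x (s * s) ⟩
        s * s - x   ∎

      0≤d : 0# ≤ d
      0≤d = proj₁ (≰⇒> d≰0)

      0<e : 0# < e
      0<e = 0<x+1 (+-nonneg (+-nonneg 0≤s 0≤s) 0≤d)

      0≤h : 0# ≤ h
      0≤h = *-nonneg 0≤d (⁻¹-nonneg 0<e)

      e*h≈d : e * h ≈ d
      e*h≈d = begin-equality
        e * (d * e ⁻¹)  ≈⟨ solve 3 (λ e d i → e :* (d :* i) := d :* (e :* i)) refl e d (e ⁻¹) ⟩
        d * (e * e ⁻¹)  ≈⟨ *-congˡ (*-inverseʳ (proj₂ 0<e ∘ sym)) ⟩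
        d * 1#          ≈⟨ *-identityʳ d ⟩
        d               ∎

      h≤1 : h ≤ 1#
      h≤1 with h ≤? 1#
      ... | yes p = p
      ... | no  h≰1 = ⊥-elim $ proj₂ (0<x+1 (+-nonneg 0≤s 0≤s)) $ antisym (proj₁ (0<x+1 (+-nonneg 0≤s 0≤s))) $
        0≤y-x⇒x≤y $ begin
          0#                     ≤⟨ x≤y⇒0≤y-x (*-monoʳ-≤ (proj₁ 0<e) (proj₁ (≰⇒> h≰1))) ⟩
          e * h - e * 1#         ≈⟨ +-congʳ e*h≈d ⟩
          d - e * 1#             ≈⟨ solve 2 (λ s d → d :- (s :+ s :+ d :+ con ℤ.1ℤ) :* con ℤ.1ℤ :=
                                                     con ℤ.0ℤ :- (s :+ s :+ con ℤ.1ℤ)) refl s d ⟩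
          0# - (s + s + 1#)      ∎

      P[s+h] : P (s + h)
      P[s+h] = +-nonneg 0≤s 0≤h , 0≤y-x⇒x≤y (begin
        0#
          ≤⟨ +-nonneg (*-nonneg 0≤h (x≤y⇒0≤y-x h≤1)) (*-nonneg 0≤d 0≤h) ⟩
        h * (1# - h) + d * h
          ≈⟨ solve 3 (λ s d h → h :* (con ℤ.1ℤ :- h) :+ d :* h :=
                       (s :+ s :+ d :+ con ℤ.1ℤ) :* h :+ (s :* s :- (s :+ h) :* (s :+ h))) refl s d h ⟩
        e * h + (s * s - (s + h) * (s + h))
          ≈⟨ +-congʳ e*h≈d ⟩
        d + (s * s - (s + h) * (s + h))
          ≈⟨ solve 3 (λ x s q → (x :- s) :+ (s :- q) := x :- q) refl x (s * s) ((s + h) * (s + h)) ⟩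
        x - (s + h) * (s + h)
          ∎)

      h≈0 : h ≈ 0#
      h≈0 = antisym
        (0≤y-x⇒x≤y (≤-trans (x≤y⇒0≤y-x (proj₁ (proj₂ lub) P[s+h]))
          (≤-reflexive (solve 2 (λ s h → s :- (s :+ h) := con ℤ.0ℤ :- h) refl s h))))
        0≤h

      d≤0 : d ≤ 0#
      d≤0 = ≤-reflexive (trans (sym e*h≈d) (trans (*-congˡ h≈0) (zeroʳ e)))

    -- If x < s² then s - h with h = (s² - x) / 2s is still an upper bound of P.
    s²≤x : s * s ≤ x
    s²≤x with s * s ≤? x
    ... | yes p = p
    ... | no  s²≰x = ⊥-elim (s²≰x s²≤x′)
      where
      d h : ℝ
      d = s * s - x
      h = d * (s + s) ⁻¹

      0≤d : 0# ≤ d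
      0≤d = x≤y⇒0≤y-x (proj₁ (≰⇒> s²≰x))

      s+s≉0 : s + s ≉ 0#
      s+s≉0 s+s≈0 = s²≰x $ begin
        s * s   ≈⟨ *-congʳ (x+x≈0⇒x≈0 s+s≈0) ⟩
        0# * s  ≈⟨ zeroˡ s ⟩
        0#      ≤⟨ 0≤x ⟩
        x       ∎

      0<s+s : 0# < s + s
      0<s+s = +-nonneg 0≤s 0≤s , s+s≉0 ∘ sym

      0≤h : 0# ≤ h
      0≤h = *-nonneg 0≤d (⁻¹-nonneg 0<s+s)

      2sh≈d : (s + s) * h ≈ d
      2sh≈d = begin-equality
        (s + s) * (d * (s + s) ⁻¹)  ≈⟨ solve 3 (λ e d i → e :* (d :* i) := d :* (e :* i)) refl (s + s) d ((s + s) ⁻¹) ⟩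
        d * ((s + s) * (s + s) ⁻¹)  ≈⟨ *-congˡ (*-inverseʳ s+s≉0) ⟩
        d * 1#                      ≈⟨ *-identityʳ d ⟩
        d                           ∎

      h≤s : h ≤ s
      h≤s with h ≤? s
      ... | yes p = p
      ... | no  h≰s = ⊥-elim (s+s≉0 (trans (+-cong s≈0 s≈0) (+-identityˡ 0#)))
        where
        ss≤0 : s * s ≤ 0#
        ss≤0 = 0≤y-x⇒x≤y $ begin
          0#
            ≤⟨ +-nonneg (x≤y⇒0≤y-x (*-monoʳ-≤ (proj₁ 0<s+s) (proj₁ (≰⇒> h≰s)))) 0≤x ⟩
          ((s + s) * h - (s + s) * s) + x
            ≈⟨ +-congʳ (+-congʳ 2sh≈d) ⟩
          (d - (s + s) * s) + x
            ≈⟨ solve 2 (λ s x → ((s :* s :- x) :- (s :+ s) :* s) :+ x := con ℤ.0ℤ :- s :* s) refl s x ⟩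
          0# - s * s
            ∎
        s≈0 : s ≈ 0#
        s≈0 = x*x≈0⇒x≈0 (antisym ss≤0 (0≤x*x s))

      s-h-bound : UpperBound P (s - h)
      s-h-bound {y} (_ , yy≤x) = x*x≤y*y⇒x≤y (x≤y⇒0≤y-x h≤s) $ begin
        y * y                            ≤⟨ yy≤x ⟩
        x                                ≈⟨ solve 2 (λ s x → x := s :* s :- (s :* s :- x)) refl s x ⟩
        s * s - d                        ≈⟨ +-congˡ (-‿cong 2sh≈d) ⟨
        s * s - (s + s) * h              ≤⟨ 0≤y-x⇒x≤y (≤-trans (0≤x*x h) (≤-reflexive
                                              (solve 2 (λ s h → h :* h :=
                                                (s :- h) :* (s :- h) :- (s :* s :- (s :+ s) :* h)) refl s h))) ⟩
        (s - h) * (s - h)                ∎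

      h≈0 : h ≈ 0#
      h≈0 = antisym
        (0≤y-x⇒x≤y (≤-trans (x≤y⇒0≤y-x (proj₂ (proj₂ lub) s-h-bound))
          (≤-reflexive (solve 2 (λ s h → (s :- h) :- s := con ℤ.0ℤ :- h) refl s h))))
        0≤h

      s²≤x′ : s * s ≤ x
      s²≤x′ = ≤-reflexive (x-y≈0⇒x≈y _ _ (trans (sym 2sh≈d) (trans (*-congˡ h≈0) (zeroʳ _))))

    unique : ∀ {r} → 0# ≤ r × r * r ≈ x → s ≈ r
    unique (0≤r , rr≈x) = antisym
      (x*x≤y*y⇒x≤y 0≤r (≤-trans s²≤x (≤-reflexive (sym rr≈x))))
      (x*x≤y*y⇒x≤y 0≤s (≤-trans (≤-reflexive rr≈x) x≤s²))

  -- Abstract because unfolding the supremum makes conversion checking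
  -- explode; the root is determined by its specification.

  abstract
    √-exists : ∀ {x} → 0# ≤ x → ∃! _≈_ λ r → 0# ≤ r × r * r ≈ x
    √-exists = √-construction

data Literal (n : ℕ) : Set where
  pos neg : Fin n → Literal n

data Comparison : Set where
  atLeast atMost exactly : Comparison

data Clause (n : ℕ) : Set where
  cnf  : List (Literal n) → Clause n
  card : Comparison → ℕ → List (Literal n) → Clause n
  xor  : List (Literal n) → Clause n
  nae  : List (Literal n) → Clause n

Formula : ℕ → ℕ → Set
Formula n m = Vector (Clause n) m

Assignment : ℕ → Set
Assignment = Vec Bool

⟦_⟧ˡ : ∀ {n} → Literal n → Assignment n → Bool
⟦ pos i ⟧ˡ a = lookup a i
⟦ neg i ⟧ˡ a = not (lookup a i)

compare : Comparison → ℕ → ℕ → Bool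
compare atLeast k c = k ≤ᵇ c
compare atMost  k c = c ≤ᵇ k
compare exactly k c = c ≡ᵇ k

⟦_⟧ᶜ : ∀ {n} → Clause n → Assignment n → Bool
⟦ cnf ls      ⟧ᶜ a = any (λ l → ⟦ l ⟧ˡ a) ls
⟦ card ⋈ k ls ⟧ᶜ a = compare ⋈ k (length (filterᵇ (λ l → ⟦ l ⟧ˡ a) ls))
⟦ xor ls      ⟧ᶜ a = foldr _xor_ false (map (λ l → ⟦ l ⟧ˡ a) ls)
⟦ nae ls      ⟧ᶜ a = any (λ l → ⟦ l ⟧ˡ a) ls ∧ any (λ l → not (⟦ l ⟧ˡ a)) ls

module ProjectedGradientDescent (R : Reals) where

  open Reals R
  open RealProperties R
  open Solver using (solve; _:=_; _:+_; _:*_; _:-_; con)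
  open SemiringSum semiring using (sum; ∑-distrib-+)
  open VectorEquality setoid using (_≋_)
  open ≤-Reasoning poset

  -- True is encoded as -1.

  ±1 : Bool → ℝ
  ±1 true  = - 1#
  ±1 false = 1#

  Point : ℕ → Set
  Point n = Vector ℝ n

  corner : ∀ {n} → Assignment n → Point n
  corner a i = ±1 (lookup a i)

  -- Multilinear polynomials, given by the coefficients of the monomials
  -- ∏ (i ∈ S) xᵢ.

  MultilinearPolynomial : ℕ → Set
  MultilinearPolynomial n = Subset n → ℝ

  infix 4 _≐_

  _≐_ : ∀ {n} → Rel (MultilinearPolynomial n) 0ℓ
  p ≐ q = ∀ S → p S ≈ q S

  monomial : ∀ {n} → Subset n → Point n → ℝ
  monomial []            x = 1#
  monomial (outside ∷ S) x = monomial S (tail x)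
  monomial (inside  ∷ S) x = head x * monomial S (tail x)

  ∑-subsets : ∀ {n} → (Subset n → ℝ) → ℝ
  ∑-subsets {zero}  g = g []
  ∑-subsets {suc n} g = ∑-subsets (g ∘ (outside ∷_)) + ∑-subsets (g ∘ (inside ∷_))

  eval : ∀ {n} → MultilinearPolynomial n → Point n → ℝ
  eval p x = ∑-subsets λ S → p S * monomial S x

  -- Formal partial derivative: the coefficient of S is that of S ∪ {i}
  -- when i ∉ S, and zero otherwise.

  ∂ : ∀ {n} → Fin n → MultilinearPolynomial n → MultilinearPolynomial n
  ∂ i p S = if lookup S i then 0# else p (S [ i ]≔ inside)

  ∇ : ∀ {n} → MultilinearPolynomial n → Point n → Point n
  ∇ p x i = eval (∂ i p) x

  ∑-subsets-cong : ∀ {n} {g h : Subset n → ℝ} → (∀ S → g S ≈ h S) → ∑-subsets g ≈ ∑-subsets h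
  ∑-subsets-cong {zero}  g≈h = g≈h []
  ∑-subsets-cong {suc n} g≈h = +-cong (∑-subsets-cong (g≈h ∘ (outside ∷_))) (∑-subsets-cong (g≈h ∘ (inside ∷_)))

  ∑-subsets-linear : ∀ {n} a b (g h : Subset n → ℝ) →
                     ∑-subsets (λ S → a * g S + b * h S) ≈ a * ∑-subsets g + b * ∑-subsets h
  ∑-subsets-linear {zero}  a b g h = refl
  ∑-subsets-linear {suc n} a b g h = trans
    (+-cong (∑-subsets-linear a b (g ∘ (outside ∷_)) (h ∘ (outside ∷_)))
            (∑-subsets-linear a b (g ∘ (inside ∷_)) (h ∘ (inside ∷_))))
    (solve 6 (λ a b g₀ g₁ h₀ h₁ → (a :* g₀ :+ b :* h₀) :+ (a :* g₁ :+ b :* h₁) :=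
                                  a :* (g₀ :+ g₁) :+ b :* (h₀ :+ h₁)) refl a b
      (∑-subsets (g ∘ (outside ∷_))) (∑-subsets (g ∘ (inside ∷_)))
      (∑-subsets (h ∘ (outside ∷_))) (∑-subsets (h ∘ (inside ∷_))))

  eval-cong : ∀ {n} {p q : MultilinearPolynomial n} → p ≐ q → ∀ x → eval p x ≈ eval q x
  eval-cong p≐q x = ∑-subsets-cong (*-congʳ ∘ p≐q)

  eval-linear : ∀ {n} a b (p q : MultilinearPolynomial n) x →
                eval (λ S → a * p S + b * q S) x ≈ a * eval p x + b * eval q x
  eval-linear a b p q x = trans
    (∑-subsets-cong λ S → solve 5 (λ a b p q m → (a :* p :+ b :* q) :* m := a :* (p :* m) :+ b :* (q :* m))
                            refl a b (p S) (q S) (monomial S x))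
    (∑-subsets-linear a b (λ S → p S * monomial S x) (λ S → q S * monomial S x))

  eval-∷ : ∀ {n} (p : MultilinearPolynomial (suc n)) x →
           eval p x ≈ eval (p ∘ (outside ∷_)) (tail x) + head x * eval (p ∘ (inside ∷_)) (tail x)
  eval-∷ p x = +-congˡ $ begin-equality
    ∑-subsets (λ S → p (inside ∷ S) * (head x * monomial S (tail x)))
      ≈⟨ ∑-subsets-cong (λ S → solve 3 (λ p h m → p :* (h :* m) := h :* (p :* m) :+ con ℤ.0ℤ :* (p :* m))
                                 refl (p (inside ∷ S)) (head x) (monomial S (tail x))) ⟩
    ∑-subsets (λ S → head x * (p (inside ∷ S) * monomial S (tail x)) + 0# * (p (inside ∷ S) * monomial S (tail x)))
      ≈⟨ ∑-subsets-linear (head x) 0# term term ⟩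
    head x * eval (p ∘ (inside ∷_)) (tail x) + 0# * eval (p ∘ (inside ∷_)) (tail x)
      ≈⟨ solve 2 (λ h e → h :* e :+ con ℤ.0ℤ :* e := h :* e) refl (head x) (∑-subsets term) ⟩
    head x * eval (p ∘ (inside ∷_)) (tail x)
      ∎
    where
    term : Subset _ → ℝ
    term S = p (inside ∷ S) * monomial S (tail x)

  Agrees : ∀ {n} → (Assignment n → ℝ) → MultilinearPolynomial n → Set
  Agrees g p = ∀ a → eval p (corner a) ≈ g a

  interpolation : ∀ {n} (g : Assignment n → ℝ) → ∃ (Agrees g)
  interpolation {zero}  g = (λ _ → g []) , λ { [] → *-identityʳ _ }
  interpolation {suc n} g = r , agrees
    where
    F T : ∃ (Agrees _)
    F = interpolation (g ∘ (false ∷_))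
    T = interpolation (g ∘ (true ∷_))
    p q : MultilinearPolynomial n
    p = proj₁ F
    q = proj₁ T
    r : MultilinearPolynomial (suc n)
    r (outside ∷ S) = ½ * p S + ½ * q S
    r (inside  ∷ S) = ½ * p S + (- ½) * q S

    r-eval : ∀ b a → eval r (corner (b ∷ a)) ≈
                     (½ * g (false ∷ a) + ½ * g (true ∷ a)) + ±1 b * (½ * g (false ∷ a) + (- ½) * g (true ∷ a))
    r-eval b a = begin-equality
      eval r (corner (b ∷ a))
        ≈⟨ eval-∷ r (corner (b ∷ a)) ⟩
      eval (r ∘ (outside ∷_)) (corner a) + ±1 b * eval (r ∘ (inside ∷_)) (corner a)
        ≈⟨ +-cong (eval-linear ½ ½ p q (corner a)) (*-congˡ (eval-linear ½ (- ½) p q (corner a))) ⟩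
      (½ * eval p (corner a) + ½ * eval q (corner a)) + ±1 b * (½ * eval p (corner a) + (- ½) * eval q (corner a))
        ≈⟨ +-cong (+-cong (*-congˡ hp) (*-congˡ hq)) (*-congˡ (+-cong (*-congˡ hp) (*-congˡ hq))) ⟩
      _ ∎
      where
      hp = proj₂ F a
      hq = proj₂ T a

    agrees : Agrees g r
    agrees (false ∷ a) = trans (r-eval false a) (trans
      (solve 3 (λ h x y → (h :* x :+ h :* y) :+ con ℤ.1ℤ :* (h :* x :+ (Solver.:- h) :* y) := h :* x :+ h :* x)
        refl ½ (g (false ∷ a)) (g (true ∷ a)))
      (halve _))
    agrees (true ∷ a) = trans (r-eval true a) (trans
      (solve 3 (λ h x y → (h :* x :+ h :* y) :+ (Solver.:- con ℤ.1ℤ) :* (h :* x :+ (Solver.:- h) :* y) := h :* y :+ h :* y)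
        refl ½ (g (false ∷ a)) (g (true ∷ a)))
      (halve _))

  interpolation-unique : ∀ {n} (p q : MultilinearPolynomial n) →
                         (∀ a → eval p (corner a) ≈ eval q (corner a)) → p ≐ q
  interpolation-unique {zero}  p q p≈q [] = trans (sym (*-identityʳ _)) (trans (p≈q []) (*-identityʳ _))
  interpolation-unique {suc n} p q p≈q = λ
    { (outside ∷ S) → interpolation-unique p₀ q₀ (proj₁ ∘ parts) S
    ; (inside  ∷ S) → interpolation-unique p₁ q₁ (proj₂ ∘ parts) S
    }
    where
    p₀ p₁ q₀ q₁ : MultilinearPolynomial n
    p₀ = p ∘ (outside ∷_)
    p₁ = p ∘ (inside ∷_)
    q₀ = q ∘ (outside ∷_)
    q₁ = q ∘ (inside ∷_)

    parts : ∀ a → eval p₀ (corner a) ≈ eval q₀ (corner a) × eval p₁ (corner a) ≈ eval q₁ (corner a)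
    parts a =
      (begin-equality
        P₀                          ≈⟨ halve P₀ ⟨
        ½ * P₀ + ½ * P₀             ≈⟨ even P₀ P₁ ⟩
        ½ * (P₀ + 1# * P₁) + ½ * (P₀ + - 1# * P₁)  ≈⟨ +-cong (*-congˡ f) (*-congˡ t) ⟩
        ½ * (Q₀ + 1# * Q₁) + ½ * (Q₀ + - 1# * Q₁)  ≈⟨ even Q₀ Q₁ ⟨
        ½ * Q₀ + ½ * Q₀             ≈⟨ halve Q₀ ⟩
        Q₀                          ∎) ,
      (begin-equality
        P₁                          ≈⟨ halve P₁ ⟨
        ½ * P₁ + ½ * P₁             ≈⟨ odd P₀ P₁ ⟩
        ½ * (P₀ + 1# * P₁) - ½ * (P₀ + - 1# * P₁)  ≈⟨ +-cong (*-congˡ f) (-‿cong (*-congˡ t)) ⟩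
        ½ * (Q₀ + 1# * Q₁) - ½ * (Q₀ + - 1# * Q₁)  ≈⟨ odd Q₀ Q₁ ⟨
        ½ * Q₁ + ½ * Q₁             ≈⟨ halve Q₁ ⟩
        Q₁                          ∎)
      where
      P₀ P₁ Q₀ Q₁ : ℝ
      P₀ = eval p₀ (corner a)
      P₁ = eval p₁ (corner a)
      Q₀ = eval q₀ (corner a)
      Q₁ = eval q₁ (corner a)

      f : P₀ + 1# * P₁ ≈ Q₀ + 1# * Q₁
      f = trans (sym (eval-∷ p (corner (false ∷ a)))) (trans (p≈q (false ∷ a)) (eval-∷ q (corner (false ∷ a))))

      t : P₀ + - 1# * P₁ ≈ Q₀ + - 1# * Q₁
      t = trans (sym (eval-∷ p (corner (true ∷ a)))) (trans (p≈q (true ∷ a)) (eval-∷ q (corner (true ∷ a))))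

      even : ∀ u v → ½ * u + ½ * u ≈ ½ * (u + 1# * v) + ½ * (u + - 1# * v)
      even = solve 3 (λ h u v → h :* u :+ h :* u :=
                       h :* (u :+ con ℤ.1ℤ :* v) :+ h :* (u :+ (Solver.:- con ℤ.1ℤ) :* v)) refl ½

      odd : ∀ u v → ½ * v + ½ * v ≈ ½ * (u + 1# * v) - ½ * (u + - 1# * v)
      odd = solve 3 (λ h u v → h :* v :+ h :* v :=
                      h :* (u :+ con ℤ.1ℤ :* v) :- h :* (u :+ (Solver.:- con ℤ.1ℤ) :* v)) refl ½

  fourierExpansion : ∀ {n} (c : Clause n) → ∃! _≐_ (Agrees (±1 ∘ ⟦ c ⟧ᶜ))
  fourierExpansion c = proj₁ FE-exists , proj₂ FE-exists , λ {q} agrees →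
    interpolation-unique (proj₁ FE-exists) q λ a → trans (proj₂ FE-exists a) (sym (agrees a))
    where FE-exists = interpolation (±1 ∘ ⟦ c ⟧ᶜ)

  FE : ∀ {n} → Clause n → MultilinearPolynomial n
  FE c = proj₁ (fourierExpansion c)

  objective : ∀ {n m} → Formula n m → MultilinearPolynomial n
  objective f S = sum λ j → FE (f j) S

  sum-nonneg : ∀ {n} (v : Point n) → (∀ i → 0# ≤ v i) → 0# ≤ sum v
  sum-nonneg {zero}  v 0≤v = ≤-refl
  sum-nonneg {suc n} v 0≤v = +-nonneg (0≤v zero) (sum-nonneg (tail v) (0≤v ∘ suc))

  0≤∑v² : ∀ {n} (v : Point n) → 0# ≤ sum λ i → v i * v i
  0≤∑v² v = sum-nonneg _ λ i → 0≤x*x (v i)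

  ‖_‖₂ : ∀ {n} → Point n → ℝ
  ‖ v ‖₂ = proj₁ (√-exists (0≤∑v² v))

  ‖‖₂² : ∀ {n} (v : Point n) → ‖ v ‖₂ * ‖ v ‖₂ ≈ sum λ i → v i * v i
  ‖‖₂² v = proj₂ (proj₁ (proj₂ (√-exists (0≤∑v² v))))

  infixl 6 _⊖ᵥ_
  infixl 7 _⊛_

  _⊖ᵥ_ : ∀ {n} → Point n → Point n → Point n
  (x ⊖ᵥ y) i = x i - y i

  _⊛_ : ∀ {n} → ℝ → Point n → Point n
  (a ⊛ x) i = a * x i

  InCube : ∀ {n} → Pred (Point n) 0ℓ
  InCube x = ∀ i → - 1# ≤ x i × x i ≤ 1#

  halfSquaredDistance : ∀ {n} → Point n → Point n → ℝ
  halfSquaredDistance x y = ½ * (‖ x ⊖ᵥ y ‖₂ * ‖ x ⊖ᵥ y ‖₂)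

  IsProjection : ∀ {n} → Point n → Point n → Set
  IsProjection y p = InCube p × (∀ x → InCube x → halfSquaredDistance p y ≤ halfSquaredDistance x y)

  nearest : ∀ y → ∃ λ c → (- 1# ≤ c × c ≤ 1#) × (∀ {z} → - 1# ≤ z → z ≤ 1# → 0# ≤ (z - c) * (c - y))
  nearest y with y ≤? 1# | - 1# ≤? y
  ... | no y≰1 | _ = 1# , (-1≤1 , ≤-refl) , λ {z} _ z≤1 → ≤-trans
        (*-nonneg (x≤y⇒0≤y-x z≤1) (x≤y⇒0≤y-x (proj₁ (≰⇒> y≰1))))
        (≤-reflexive (solve 3 (λ o z y → (o :- z) :* (y :- o) := (z :- o) :* (o :- y)) refl 1# z y))
    where
    -1≤1 = 0≤y-x⇒x≤y (≤-trans (+-nonneg 0≤1 0≤1) (≤-reflexive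
      (solve 1 (λ o → o :+ o := o :- (Solver.:- o)) refl 1#)))
  ... | yes _ | no -1≰y = - 1# , (≤-refl , -1≤1) , λ {z} -1≤z _ →
        *-nonneg (x≤y⇒0≤y-x -1≤z) (x≤y⇒0≤y-x (proj₁ (≰⇒> -1≰y)))
    where
    -1≤1 = 0≤y-x⇒x≤y (≤-trans (+-nonneg 0≤1 0≤1) (≤-reflexive
      (solve 1 (λ o → o :+ o := o :- (Solver.:- o)) refl 1#)))
  ... | yes y≤1 | yes -1≤y = y , (-1≤y , y≤1) , λ {z} _ _ →
        ≤-reflexive (solve 2 (λ z y → con ℤ.0ℤ := (z :- y) :* (y :- y)) refl z y)

  projection : ∀ {n} (y : Point n) → ∃! _≋_ (IsProjection y)
  projection {n} y = c , (c∈cube , minimal) , λ {z} → unique z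
    where
    c : Point n
    c i = proj₁ (nearest (y i))

    c∈cube : InCube c
    c∈cube i = proj₁ (proj₂ (nearest (y i)))

    sq : Point n → ℝ
    sq v = sum λ i → v i * v i

    sum-mono-≤ : ∀ {k} (u v : Point k) → (∀ i → u i ≤ v i) → sum u ≤ sum v
    sum-mono-≤ {zero}  u v u≤v = ≤-refl
    sum-mono-≤ {suc k} u v u≤v = +-mono-≤ (u≤v zero) (sum-mono-≤ (tail u) (tail v) (u≤v ∘ suc))

    pythagoras : ∀ z → InCube z → sq (c ⊖ᵥ y) + sq (z ⊖ᵥ c) ≤ sq (z ⊖ᵥ y)
    pythagoras z z∈cube = ≤-trans (≤-reflexive (sym (∑-distrib-+ (λ i → (c ⊖ᵥ y) i * (c ⊖ᵥ y) i) (λ i → (z ⊖ᵥ c) i * (z ⊖ᵥ c) i)))) (sum-mono-≤ _ _ λ i →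
      let 0≤p = proj₂ (proj₂ (nearest (y i))) (proj₁ (z∈cube i)) (proj₂ (z∈cube i)) in
      0≤y-x⇒x≤y (≤-trans (+-nonneg 0≤p 0≤p) (≤-reflexive
        (solve 3 (λ z c y → (z :- c) :* (c :- y) :+ (z :- c) :* (c :- y) :=
                   (z :- y) :* (z :- y) :- ((c :- y) :* (c :- y) :+ (z :- c) :* (z :- c)))
          refl (z i) (c i) (y i)))))

    minimal : ∀ z → InCube z → halfSquaredDistance c y ≤ halfSquaredDistance z y
    minimal z z∈cube = *-monoʳ-≤ 0≤½ $ begin
      ‖ c ⊖ᵥ y ‖₂ * ‖ c ⊖ᵥ y ‖₂       ≈⟨ ‖‖₂² (c ⊖ᵥ y) ⟩
      sq (c ⊖ᵥ y)                     ≈⟨ +-identityʳ _ ⟨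
      sq (c ⊖ᵥ y) + 0#                ≤⟨ +-monoʳ-≤ _ (0≤∑v² (z ⊖ᵥ c)) ⟩
      sq (c ⊖ᵥ y) + sq (z ⊖ᵥ c)       ≤⟨ pythagoras z z∈cube ⟩
      sq (z ⊖ᵥ y)                     ≈⟨ ‖‖₂² (z ⊖ᵥ y) ⟨
      ‖ z ⊖ᵥ y ‖₂ * ‖ z ⊖ᵥ y ‖₂       ∎

    sum≤0⇒≈0 : ∀ {k} (v : Point k) → (∀ i → 0# ≤ v i) → sum v ≤ 0# → ∀ i → v i ≈ 0#
    sum≤0⇒≈0 v 0≤v ∑≤0 zero = antisym
      (≤-trans (≤-trans (≤-reflexive (sym (+-identityʳ _))) (+-monoʳ-≤ _ (sum-nonneg (tail v) (0≤v ∘ suc)))) ∑≤0)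
      (0≤v zero)
    sum≤0⇒≈0 v 0≤v ∑≤0 (suc i) = sum≤0⇒≈0 (tail v) (0≤v ∘ suc)
      (≤-trans (≤-trans (≤-reflexive (sym (+-identityˡ _))) (+-mono-≤ (0≤v zero) ≤-refl)) ∑≤0) i

    unique : ∀ z → IsProjection y z → c ≋ z
    unique z (z∈cube , z-minimal) i = begin-equality
      c i                  ≈⟨ +-identityʳ _ ⟨
      c i + 0#             ≈⟨ +-congˡ (x*x≈0⇒x≈0 (sum≤0⇒≈0 _ (λ i → 0≤x*x (z i - c i)) ∑≤0 i)) ⟨
      c i + (z i - c i)    ≈⟨ solve 2 (λ c z → c :+ (z :- c) := z) refl (c i) (z i) ⟩
      z i                  ∎
      where
      z≤c : sq (z ⊖ᵥ y) ≤ sq (c ⊖ᵥ y)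
      z≤c = begin
        sq (z ⊖ᵥ y)                                              ≈⟨ ‖‖₂² (z ⊖ᵥ y) ⟨
        ‖ z ⊖ᵥ y ‖₂ * ‖ z ⊖ᵥ y ‖₂                                ≈⟨ halve (‖ z ⊖ᵥ y ‖₂ * ‖ z ⊖ᵥ y ‖₂) ⟨
        halfSquaredDistance z y + halfSquaredDistance z y        ≤⟨ +-mono-≤ (z-minimal c c∈cube) (z-minimal c c∈cube) ⟩
        halfSquaredDistance c y + halfSquaredDistance c y        ≈⟨ halve (‖ c ⊖ᵥ y ‖₂ * ‖ c ⊖ᵥ y ‖₂) ⟩
        ‖ c ⊖ᵥ y ‖₂ * ‖ c ⊖ᵥ y ‖₂                                ≈⟨ ‖‖₂² (c ⊖ᵥ y) ⟩
        sq (c ⊖ᵥ y)                                              ∎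

      ∑≤0 : sq (z ⊖ᵥ c) ≤ 0#
      ∑≤0 = 0≤y-x⇒x≤y $ begin
        0#
          ≤⟨ +-nonneg (x≤y⇒0≤y-x (pythagoras z z∈cube)) (x≤y⇒0≤y-x z≤c) ⟩
        (sq (z ⊖ᵥ y) - (sq (c ⊖ᵥ y) + sq (z ⊖ᵥ c))) + (sq (c ⊖ᵥ y) - sq (z ⊖ᵥ y))
          ≈⟨ solve 3 (λ a b d → (a :- (b :+ d)) :+ (b :- a) := con ℤ.0ℤ :- d) refl
               (sq (z ⊖ᵥ y)) (sq (c ⊖ᵥ y)) (sq (z ⊖ᵥ c)) ⟩
        0# - sq (z ⊖ᵥ c)
          ∎

  Π : ∀ {n} → Point n → Point n
  Π y = proj₁ (projection y)

  gradientMapping : ∀ {n} → ℝ → MultilinearPolynomial n → Point n → Point n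
  gradientMapping η F x = (1# / η) ⊛ (x ⊖ᵥ Π (x ⊖ᵥ η ⊛ ∇ F x))

  iterates : ∀ {n} → ℝ → MultilinearPolynomial n → Point n → ℕ → Point n
  iterates η F x₀ zero    = x₀
  iterates η F x₀ (suc t) = Π (xₜ ⊖ᵥ η ⊛ ∇ F xₜ)
    where xₜ = iterates η F x₀ t

{-# OPTIONS --safe #-}
module Submission where

-- A multilinear polynomial bounded by M on the corners of the cube is bounded
-- by M on the cube, and so is each of its partial derivatives, half the
-- difference of two of its values.  All second derivatives are then bounded by
-- M and the pure ones vanish, so the gradient is nM-Lipschitz.  For M = m and
-- η = 1/nm each projected step therefore lowers F by at least η‖G‖²/2.  As F
-- varies by at most 2m, fewer than 4nm²/ε² + 1 steps can have ‖G‖ ≥ ε.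

open import Defs
import Algebra.Properties.Semiring.Mult as SemiringMult
import Algebra.Properties.Semiring.Sum as SemiringSum
open import Data.Bool.Base using (true; false)
open import Data.Empty using (⊥-elim)
open import Data.Fin.Base using (zero; suc)
open import Data.Fin.Subset using (inside; outside)
import Data.Integer.Base as ℤ
import Data.Nat.Properties as ℕ
open import Data.Nat.Base as ℕ using (ℕ; zero; suc; NonZero)
open import Data.Sum.Base using (_⊎_; inj₁; inj₂)
open import Data.Product using (∃; _×_; _,_; proj₁; proj₂)
open import Data.Vec.Base as Vec using ([])
open import Data.Vec.Functional using (head; tail; _∷_)
open import Data.Vec.Functional.Relation.Binary.Equality.Setoid using (_≋_)
open import Function.Base using (_∘_; _$_)
import Relation.Binary.PropositionalEquality.Core as ≡
import Relation.Binary.Reasoning.PartialOrder as ≤-Reasoning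
open import Relation.Nullary.Decidable.Core using (yes; no)

module Convergence (R : Reals) where

  open Reals R
  open RealProperties R
  open ProjectedGradientDescent R
  open Solver using (solve; _:=_; _:+_; _:*_; _:-_; :-_; con)
  open SemiringMult semiring using (×1-homo-*)
  open SemiringSum semiring using (sum; sum-cong-≋; *-distribˡ-sum)
  open ≤-Reasoning poset

  -- Inequalities in an ordered field.

  difference-nonneg : ∀ {x y z} → 0# ≤ z → z ≈ y - x → x ≤ y
  difference-nonneg 0≤z z≈y-x = 0≤y-x⇒x≤y (≤-trans 0≤z (≤-reflexive z≈y-x))

  -- Many estimates below are proved in doubled form, because the ring solver has integer
  -- coefficients and knows nothing of `½`; this removes the factor two.
  halve-nonneg : ∀ {x} → 0# ≤ x + x → 0# ≤ x
  halve-nonneg {x} 0≤x+x = begin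
    0#               ≤⟨ *-nonneg 0≤½ 0≤x+x ⟩
    ½ * (x + x)      ≈⟨ distribˡ ½ x x ⟩
    ½ * x + ½ * x    ≈⟨ halve x ⟩
    x                ∎

  halve-≤ : ∀ {x y} → x + x ≤ y + y → x ≤ y
  halve-≤ {x} {y} x+x≤y+y = 0≤y-x⇒x≤y $ halve-nonneg $ ≤-trans (x≤y⇒0≤y-x x+x≤y+y) $ ≤-reflexive $
    solve 2 (λ x y → (y :+ y) :- (x :+ x) := (y :- x) :+ (y :- x)) refl x y

  sum-mono-≤ : ∀ {n} (u v : Point n) → (∀ i → u i ≤ v i) → sum u ≤ sum v
  sum-mono-≤ {zero}  u v u≤v = ≤-refl
  sum-mono-≤ {suc n} u v u≤v = +-mono-≤ (u≤v zero) (sum-mono-≤ (tail u) (tail v) (u≤v ∘ suc))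

  ∑² : ∀ {n} → Point n → ℝ
  ∑² v = sum λ i → v i * v i

  -- Bounds on the cube and restriction of the first variable.

  Bounded : ∀ {n} → ℝ → MultilinearPolynomial n → Set
  Bounded M p = ∀ x → InCube x → - M ≤ eval p x × eval p x ≤ M

  nonneg-bound : ∀ {c M} → - M ≤ c → c ≤ M → 0# ≤ M
  nonneg-bound {c} {M} -M≤c c≤M = halve-nonneg $ ≤-trans (x≤y⇒0≤y-x (≤-trans -M≤c c≤M)) $
    ≤-reflexive (+-congˡ (solve 1 (λ M → :- (:- M) := M) refl M))

  -1≤1 : - 1# ≤ 1#
  -1≤1 = difference-nonneg (+-nonneg 0≤1 0≤1) (solve 1 (λ o → o :+ o := o :- (:- o)) refl 1#)

  cube-∷ : ∀ {n a} {u : Point n} → - 1# ≤ a → a ≤ 1# → InCube u → InCube (a ∷ u)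
  cube-∷ -1≤a a≤1 u∈cube zero    = -1≤a , a≤1
  cube-∷ -1≤a a≤1 u∈cube (suc i) = u∈cube i

  -- Substitutes `a` for the first variable, which drives the inductions on the number of variables.
  -- The factor `1#` gives the coefficients the shape that `eval-linear` expects.
  restrict : ∀ {n} → ℝ → MultilinearPolynomial (suc n) → MultilinearPolynomial n
  restrict a p S = 1# * p (outside Vec.∷ S) + a * p (inside Vec.∷ S)

  eval-restrict : ∀ {n} a (p : MultilinearPolynomial (suc n)) u →
                  eval (restrict a p) u ≈
                  eval (p ∘ (outside Vec.∷_)) u + a * eval (p ∘ (inside Vec.∷_)) u
  eval-restrict a p u = trans
    (eval-linear 1# a (p ∘ (outside Vec.∷_)) (p ∘ (inside Vec.∷_)) u)
    (+-congʳ (*-identityˡ _))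

  eval-restrict-head : ∀ {n} (p : MultilinearPolynomial (suc n)) x →
                       eval p x ≈ eval (restrict (head x) p) (tail x)
  eval-restrict-head p x = trans (eval-∷ p x) (sym (eval-restrict (head x) p (tail x)))

  restrict-bounded : ∀ {n M a} (p : MultilinearPolynomial (suc n)) → Bounded M p →
                     - 1# ≤ a → a ≤ 1# → Bounded M (restrict a p)
  restrict-bounded {a = a} p bound -1≤a a≤1 u u∈cube =
    ≤-trans (proj₁ b) (≤-reflexive e) , ≤-trans (≤-reflexive (sym e)) (proj₂ b)
    where
    b = bound (a ∷ u) (cube-∷ -1≤a a≤1 u∈cube)
    e = eval-restrict-head p (a ∷ u)

  -- The derivative in the first variable is half the difference of the values at ±1.
  inside-bounded : ∀ {n M} (p : MultilinearPolynomial (suc n)) → Bounded M p →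
                   Bounded M (p ∘ (inside Vec.∷_))
  inside-bounded {M = M} p bound u u∈cube =
    (halve-≤ $ begin
      - M + - M                       ≤⟨ +-mono-≤ (proj₁ b₊) (negate (proj₂ b₋)) ⟩
      eval p₊ u - eval p₋ u           ≈⟨ difference ⟩
      c + c                           ∎) ,
    (halve-≤ $ begin
      c + c                           ≈⟨ difference ⟨
      eval p₊ u - eval p₋ u           ≤⟨ +-mono-≤ (proj₂ b₊) (negate (proj₁ b₋)) ⟩
      M + - - M                       ≈⟨ +-congˡ (solve 1 (λ M → :- (:- M) := M) refl M) ⟩
      M + M                           ∎)
    where
    p₊ = restrict 1# p
    p₋ = restrict (- 1#) p
    c d : ℝ
    c = eval (p ∘ (inside Vec.∷_)) u
    d = eval (p ∘ (outside Vec.∷_)) u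
    b₊ = restrict-bounded p bound -1≤1 ≤-refl u u∈cube
    b₋ = restrict-bounded p bound ≤-refl -1≤1 u u∈cube

    negate : ∀ {x y} → x ≤ y → - y ≤ - x
    negate {x} {y} x≤y = difference-nonneg (x≤y⇒0≤y-x x≤y) $
      solve 2 (λ x y → y :- x := (:- x) :- (:- y)) refl x y

    difference : eval p₊ u - eval p₋ u ≈ c + c
    difference = trans
      (+-cong (eval-restrict 1# p u) (-‿cong (eval-restrict (- 1#) p u)))
      (solve 2 (λ d c → (d :+ con ℤ.1ℤ :* c) :- (d :+ (:- con ℤ.1ℤ) :* c) := c :+ c) refl d c)

  -- Partial derivatives, split by the first variable.

  ∂-restrict : ∀ {n} a (p : MultilinearPolynomial (suc n)) i u →
               eval (∂ i (restrict a p)) u ≈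
               eval (∂ i (p ∘ (outside Vec.∷_))) u + a * eval (∂ i (p ∘ (inside Vec.∷_))) u
  ∂-restrict a p i u = trans
    (eval-cong {q = λ S → 1# * ∂ i (p ∘ (outside Vec.∷_)) S + a * ∂ i (p ∘ (inside Vec.∷_)) S} ∂-linear u)
    (trans (eval-linear 1# a (∂ i (p ∘ (outside Vec.∷_))) (∂ i (p ∘ (inside Vec.∷_))) u)
           (+-congʳ (*-identityˡ _)))
    where
    ∂-linear : ∀ S → ∂ i (restrict a p) S ≈
                     1# * ∂ i (p ∘ (outside Vec.∷_)) S + a * ∂ i (p ∘ (inside Vec.∷_)) S
    ∂-linear S with Vec.lookup S i
    ... | true  = sym (trans (+-cong (zeroʳ 1#) (zeroʳ a)) (+-identityˡ 0#))
    ... | false = refl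

  -- Differentiation in a later variable commutes with fixing the first one, so the rest of the
  -- gradient is itself a gradient in one variable fewer.
  ∇-suc : ∀ {n} (p : MultilinearPolynomial (suc n)) x i →
          ∇ p x (suc i) ≈ ∇ (restrict (head x) p) (tail x) i
  ∇-suc p x i = trans (eval-∷ (∂ (suc i) p) x) (sym (∂-restrict (head x) p i (tail x)))

  eval-zero : ∀ {n} (u : Point n) → eval (λ _ → 0#) u ≈ 0#
  eval-zero u = trans
    -- Zero is written as a combination with zero weights so that `eval-linear` evaluates it.
    (eval-cong {q = λ _ → 0# * 0# + 0# * 0#} (λ _ → sym (trans (+-cong (zeroˡ 0#) (zeroˡ 0#)) (+-identityˡ 0#))) u)
    (trans (eval-linear 0# 0# (λ _ → 0#) (λ _ → 0#) u)
           (trans (+-cong (zeroˡ _) (zeroˡ _)) (+-identityˡ 0#)))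

  -- A multilinear polynomial is affine in its first variable, so that variable no longer occurs in
  -- the derivative: `∂ zero p` vanishes on every subset containing it.
  ∇-zero : ∀ {n} (p : MultilinearPolynomial (suc n)) x → ∇ p x zero ≈ eval (p ∘ (inside Vec.∷_)) (tail x)
  ∇-zero p x = begin-equality
    ∇ p x zero                ≈⟨ eval-∷ (∂ zero p) x ⟩
    c + head x * eval (λ _ → 0#) (tail x)  ≈⟨ +-congˡ (trans (*-congˡ (eval-zero (tail x))) (zeroʳ _)) ⟩
    c + 0#                    ≈⟨ +-identityʳ c ⟩
    c                         ∎
    where c = eval (p ∘ (inside Vec.∷_)) (tail x)

  -- A quadratic bound on the linearisation error.

  weighted-product-≤ : ∀ {c M} s t → - M ≤ c → c ≤ M → s * t * c + s * t * c ≤ M * (s * s + t * t)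
  weighted-product-≤ {c} {M} s t -M≤c c≤M = 0≤y-x⇒x≤y $ halve-nonneg $ begin
    0#
      -- The nonnegative weights `c + M` and `M - c` on the two squares avoid a case split on the
      -- sign of `c`; the sum is twice the required difference.
      ≤⟨ +-nonneg (*-nonneg (x≤y⇒0≤y-x -M≤c) (0≤x*x (s - t)))
                  (*-nonneg (x≤y⇒0≤y-x c≤M) (0≤x*x (s + t))) ⟩
    (c - - M) * ((s - t) * (s - t)) + (M - c) * ((s + t) * (s + t))
      ≈⟨ solve 4 (λ c M s t →
           (c :- (:- M)) :* ((s :- t) :* (s :- t)) :+ (M :- c) :* ((s :+ t) :* (s :+ t)) :=
           (M :* (s :* s :+ t :* t) :- (s :* t :* c :+ s :* t :* c)) :+
           (M :* (s :* s :+ t :* t) :- (s :* t :* c :+ s :* t :* c))) refl c M s t ⟩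
    _ ∎

  -- Passing from `u` to `v` one coordinate at a time, each change is the coordinate difference
  -- times a derivative bounded by `M`. `weighted-product-≤` splits its product with `s` into
  -- squares, and the `n` copies of `s * s` add up. It is applied below to the derivative in the
  -- first variable, with `s` the displacement in that variable.
  weighted-variation-≤ : ∀ {n M} (p : MultilinearPolynomial n) → Bounded M p →
                         ∀ s u v → InCube u → InCube v →
                         s * (eval p v - eval p u) + s * (eval p v - eval p u) ≤
                         M * (fromℕ n * (s * s) + ∑² (v ⊖ᵥ u))
  weighted-variation-≤ {zero} {M} p bound s u v _ _ = ≤-reflexive $
    solve 3 (λ s M e → s :* (e :- e) :+ s :* (e :- e) := M :* (con ℤ.0ℤ :* (s :* s) :+ con ℤ.0ℤ))
      refl s M (eval p v)
  weighted-variation-≤ {suc n} {M} p bound s u v u∈cube v∈cube = begin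
    s * (eval p v - eval p u) + s * (eval p v - eval p u)
      ≈⟨ +-cong step step ⟩
    (s * (qv - qu) + s * t * c) + (s * (qv - qu) + s * t * c)
      ≈⟨ solve 2 (λ x y → (x :+ y) :+ (x :+ y) := (x :+ x) :+ (y :+ y)) refl (s * (qv - qu)) (s * t * c) ⟩
    (s * (qv - qu) + s * (qv - qu)) + (s * t * c + s * t * c)
      ≤⟨ +-mono-≤
           (weighted-variation-≤ q (restrict-bounded p bound (proj₁ (v∈cube zero)) (proj₂ (v∈cube zero)))
             s (tail u) (tail v) (u∈cube ∘ suc) (v∈cube ∘ suc))
           (weighted-product-≤ s t (proj₁ c-bound) (proj₂ c-bound)) ⟩
    M * (fromℕ n * (s * s) + D) + M * (s * s + t * t)
      ≈⟨ solve 5 (λ M k s t D → M :* (k :* (s :* s) :+ D) :+ M :* (s :* s :+ t :* t) :=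
                                M :* ((con ℤ.1ℤ :+ k) :* (s :* s) :+ (t :* t :+ D)))
           refl M (fromℕ n) s t D ⟩
    M * (fromℕ (suc n) * (s * s) + ∑² (v ⊖ᵥ u)) ∎
    where
    q = restrict (head v) p
    t c d qv qu D : ℝ
    t = head v - head u
    c = eval (p ∘ (inside Vec.∷_)) (tail u)
    d = eval (p ∘ (outside Vec.∷_)) (tail u)
    qv = eval q (tail v)
    qu = eval q (tail u)
    D = ∑² (tail v ⊖ᵥ tail u)
    c-bound = inside-bounded p bound (tail u) (u∈cube ∘ suc)

    -- The first coordinate moves while the others stay at `tail u`; then the others move with the
    -- first held at `head v`.
    step : s * (eval p v - eval p u) ≈ s * (qv - qu) + s * t * c
    step = begin-equality
      s * (eval p v - eval p u)
        ≈⟨ *-congˡ (+-cong (eval-restrict-head p v) (-‿cong (eval-∷ p u))) ⟩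
      s * (qv - (d + head u * c))
        ≈⟨ solve 6 (λ s q d c a b → s :* (q :- (d :+ a :* c)) :=
                     s :* (q :- (d :+ b :* c)) :+ s :* (b :- a) :* c)
             refl s qv d c (head u) (head v) ⟩
      s * (qv - (d + head v * c)) + s * t * c
        ≈⟨ +-congʳ (*-congˡ (+-congˡ (-‿cong (eval-restrict (head v) p (tail u))))) ⟨
      s * (qv - qu) + s * t * c ∎

  linearisationError : ∀ {n} → MultilinearPolynomial n → Point n → Point n → ℝ
  linearisationError p x y = (eval p y - eval p x) - sum (λ i → ∇ p x i * (y i - x i))

  -- The quadratic upper bound of a function with `nM`-Lipschitz gradient, obtained without a
  -- Hessian. The error splits into that of the restriction to `head x`, handled by induction, and a
  -- mixed term handled by `weighted-variation-≤`.
  linearisationError-≤ : ∀ {n M} (p : MultilinearPolynomial n) → Bounded M p →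
                         ∀ x y → InCube x → InCube y →
                         linearisationError p x y + linearisationError p x y ≤
                         M * (fromℕ n * ∑² (y ⊖ᵥ x))
  linearisationError-≤ {zero} {M} p bound x y _ _ = ≤-reflexive $
    solve 2 (λ M e → ((e :- e) :- con ℤ.0ℤ) :+ ((e :- e) :- con ℤ.0ℤ) := M :* (con ℤ.0ℤ :* con ℤ.0ℤ))
      refl M (eval p y)
  linearisationError-≤ {suc n} {M} p bound x y x∈cube y∈cube = begin
    linearisationError p x y + linearisationError p x y
      ≈⟨ +-cong step step ⟩
    (e + t * Δ) + (e + t * Δ)
      ≈⟨ solve 2 (λ x y → (x :+ y) :+ (x :+ y) := (x :+ x) :+ (y :+ y)) refl e (t * Δ) ⟩
    (e + e) + (t * Δ + t * Δ)
      ≤⟨ +-mono-≤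
           (linearisationError-≤ q (restrict-bounded p bound (proj₁ (x∈cube zero)) (proj₂ (x∈cube zero)))
             (tail x) (tail y) (x∈cube ∘ suc) (y∈cube ∘ suc))
           (weighted-variation-≤ p₁ (inside-bounded p bound) t
             (tail x) (tail y) (x∈cube ∘ suc) (y∈cube ∘ suc)) ⟩
    M * (fromℕ n * D) + M * (fromℕ n * (t * t) + D)
      -- The two bounds fall short of the target by exactly `M * (t * t)`.
      ≤⟨ difference-nonneg (*-nonneg 0≤M (0≤x*x t))
           (solve 4 (λ M k t D → M :* (t :* t) :=
             M :* ((con ℤ.1ℤ :+ k) :* (t :* t :+ D)) :- (M :* (k :* D) :+ M :* (k :* (t :* t) :+ D)))
             refl M (fromℕ n) t D) ⟩
    M * (fromℕ (suc n) * ∑² (y ⊖ᵥ x)) ∎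
    where
    q p₀ p₁ : MultilinearPolynomial n
    q = restrict (head x) p
    p₀ = p ∘ (outside Vec.∷_)
    p₁ = p ∘ (inside Vec.∷_)
    t Δ D e S : ℝ
    t = head y - head x
    Δ = eval p₁ (tail y) - eval p₁ (tail x)
    D = ∑² (tail y ⊖ᵥ tail x)
    e = linearisationError q (tail x) (tail y)
    S = sum λ i → ∇ q (tail x) i * (tail y i - tail x i)

    0≤M : 0# ≤ M
    0≤M = nonneg-bound (proj₁ (bound x x∈cube)) (proj₂ (bound x x∈cube))

    -- The increment in the first variable is exactly `t` times the derivative at `tail y`, whereas
    -- the linearisation takes it at `tail x`; the discrepancy is `t * Δ`.
    step : linearisationError p x y ≈ e + t * Δ
    step = begin-equality
      linearisationError p x y
        ≈⟨ +-cong (+-cong (eval-∷ p y) (-‿cong (eval-restrict-head p x)))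
             (-‿cong (+-cong (*-congʳ (∇-zero p x)) (sum-cong-≋ λ i → *-congʳ (∇-suc p x i)))) ⟩
      ((eval p₀ (tail y) + head y * eval p₁ (tail y)) - eval q (tail x)) - (eval p₁ (tail x) * t + S)
        ≈⟨ solve 7 (λ d c a b q c′ S →
             ((d :+ b :* c) :- q) :- (c′ :* (b :- a) :+ S) :=
             (((d :+ a :* c) :- q) :- S) :+ (b :- a) :* (c :- c′))
             refl (eval p₀ (tail y)) (eval p₁ (tail y)) (head x) (head y) (eval q (tail x)) (eval p₁ (tail x)) S ⟩
      (((eval p₀ (tail y) + head x * eval p₁ (tail y)) - eval q (tail x)) - S) + t * Δ
        ≈⟨ +-congʳ (+-congʳ (+-congʳ (eval-restrict (head x) p (tail y)))) ⟨
      e + t * Δ ∎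

  -- From bounds at the corners to bounds on the cube.

  affine-≥ : ∀ {L a c d} → - 1# ≤ a → a ≤ 1# → L ≤ d + 1# * c → L ≤ d + - 1# * c → L ≤ d + a * c
  affine-≥ {L} {a} {c} {d} -1≤a a≤1 L≤d+c L≤d-c = 0≤y-x⇒x≤y $ halve-nonneg $ ≤-trans
    -- Twice the value at `a` is the value at `1` weighted by `1 + a` plus the value at `-1`
    -- weighted by `1 - a`, both weights being nonnegative.
    (+-nonneg (*-nonneg (x≤y⇒0≤y-x -1≤a) (x≤y⇒0≤y-x L≤d+c)) (*-nonneg (x≤y⇒0≤y-x a≤1) (x≤y⇒0≤y-x L≤d-c)))
    (≤-reflexive $ solve 4 (λ L a c d →
      (a :- (:- con ℤ.1ℤ)) :* ((d :+ con ℤ.1ℤ :* c) :- L) :+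
      (con ℤ.1ℤ :- a) :* ((d :+ (:- con ℤ.1ℤ) :* c) :- L) :=
      ((d :+ a :* c) :- L) :+ ((d :+ a :* c) :- L)) refl L a c d)

  affine-≤ : ∀ {U a c d} → - 1# ≤ a → a ≤ 1# → d + 1# * c ≤ U → d + - 1# * c ≤ U → d + a * c ≤ U
  affine-≤ {U} {a} {c} {d} -1≤a a≤1 d+c≤U d-c≤U = 0≤y-x⇒x≤y $ halve-nonneg $ ≤-trans
    (+-nonneg (*-nonneg (x≤y⇒0≤y-x -1≤a) (x≤y⇒0≤y-x d+c≤U)) (*-nonneg (x≤y⇒0≤y-x a≤1) (x≤y⇒0≤y-x d-c≤U)))
    (≤-reflexive $ solve 4 (λ U a c d →
      (a :- (:- con ℤ.1ℤ)) :* (U :- (d :+ con ℤ.1ℤ :* c)) :+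
      (con ℤ.1ℤ :- a) :* (U :- (d :+ (:- con ℤ.1ℤ) :* c)) :=
      (U :- (d :+ a :* c)) :+ (U :- (d :+ a :* c))) refl U a c d)

  -- Since `p` is affine in its first variable, the corner bounds survive fixing that variable
  -- anywhere in `[-1,1]`; induction treats the remaining ones.
  bounded-at-corners : ∀ {n M} (p : MultilinearPolynomial n) →
                       (∀ a → - M ≤ eval p (corner a) × eval p (corner a) ≤ M) → Bounded M p
  bounded-at-corners {zero}      p bound x _ = bound []
  bounded-at-corners {suc n} {M} p bound x x∈cube =
    ≤-trans (proj₁ b) (≤-reflexive (sym e)) , ≤-trans (≤-reflexive e) (proj₂ b)
    where
    e = eval-restrict-head p x

    restricted : ∀ w → - M ≤ eval (restrict (head x) p) (corner w) × eval (restrict (head x) p) (corner w) ≤ M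
    restricted w =
      ≤-trans (affine-≥ -1≤x₀ x₀≤1 (≤-trans (proj₁ b₊) (≤-reflexive e₊)) (≤-trans (proj₁ b₋) (≤-reflexive e₋)))
              (≤-reflexive (sym e₀)) ,
      ≤-trans (≤-reflexive e₀)
        (affine-≤ -1≤x₀ x₀≤1 (≤-trans (≤-reflexive (sym e₊)) (proj₂ b₊)) (≤-trans (≤-reflexive (sym e₋)) (proj₂ b₋)))
      where
      -1≤x₀ = proj₁ (x∈cube zero)
      x₀≤1 = proj₂ (x∈cube zero)
      b₊ = bound (false Vec.∷ w)
      b₋ = bound (true Vec.∷ w)
      e₊ = eval-∷ p (corner (false Vec.∷ w))
      e₋ = eval-∷ p (corner (true Vec.∷ w))
      e₀ = eval-restrict (head x) p (corner w)

    b = bounded-at-corners (restrict (head x) p) restricted (tail x) (x∈cube ∘ suc)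

  -- At the corners the expansion agrees with a function valued in `±1`, uniformly for the four
  -- kinds of clause.
  FE-bounded : ∀ {n} (c : Clause n) → Bounded 1# (FE c)
  FE-bounded c = bounded-at-corners (FE c) λ a →
    ≤-trans (proj₁ (±1-bounded (⟦ c ⟧ᶜ a))) (≤-reflexive (sym (agrees a))) ,
    ≤-trans (≤-reflexive (agrees a)) (proj₂ (±1-bounded (⟦ c ⟧ᶜ a)))
    where
    agrees = proj₁ (proj₂ (fourierExpansion c))

    ±1-bounded : ∀ b → - 1# ≤ ±1 b × ±1 b ≤ 1#
    ±1-bounded true  = ≤-refl , -1≤1
    ±1-bounded false = -1≤1 , ≤-refl

  +-bounded : ∀ {n L M} (p q : MultilinearPolynomial n) → Bounded L p → Bounded M q →
              Bounded (L + M) (λ S → p S + q S)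
  +-bounded {L = L} {M} p q p-bound q-bound x x∈cube =
    (begin
      - (L + M)           ≈⟨ solve 2 (λ L M → :- (L :+ M) := :- L :+ :- M) refl L M ⟩
      - L + - M           ≤⟨ +-mono-≤ (proj₁ bp) (proj₁ bq) ⟩
      eval p x + eval q x ≈⟨ additive ⟨
      _                   ∎) ,
    ≤-trans (≤-reflexive additive) (+-mono-≤ (proj₂ bp) (proj₂ bq))
    where
    bp = p-bound x x∈cube
    bq = q-bound x x∈cube

    additive : eval (λ S → p S + q S) x ≈ eval p x + eval q x
    additive = trans
      (eval-cong {q = λ S → 1# * p S + 1# * q S} (λ S → sym (+-cong (*-identityˡ _) (*-identityˡ _))) x)
      (trans (eval-linear 1# 1# p q x) (+-cong (*-identityˡ _) (*-identityˡ _)))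

  objective-bounded : ∀ {n m} (f : Formula n m) → Bounded (fromℕ m) (objective f)
  objective-bounded {m = zero} f x _ =
    ≤-reflexive (trans (solve 0 (:- con ℤ.0ℤ := con ℤ.0ℤ) refl) (sym (eval-zero x))) ,
    ≤-reflexive (eval-zero x)
  objective-bounded {m = suc m} f =
    +-bounded (FE (f zero)) (objective (tail f)) (FE-bounded (f zero)) (objective-bounded (tail f))

  -- Natural numbers and reciprocals in the reals.

  0≤fromℕ : ∀ k → 0# ≤ fromℕ k
  0≤fromℕ zero    = ≤-refl
  0≤fromℕ (suc k) = +-nonneg 0≤1 (0≤fromℕ k)

  fromℕ≉0 : ∀ k .{{_ : NonZero k}} → fromℕ k ≉ 0#
  fromℕ≉0 (suc k) 1+k≈0 = proj₂ (0<x+1 (0≤fromℕ k)) (trans (sym 1+k≈0) (+-comm _ _))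

  1+k≤k⇒1≤0 : ∀ k → fromℕ (suc k) ≤ fromℕ k → 1# ≤ 0#
  1+k≤k⇒1≤0 k 1+k≤k = difference-nonneg (x≤y⇒0≤y-x 1+k≤k) $
    solve 1 (λ k → k :- (con ℤ.1ℤ :+ k) := con ℤ.0ℤ :- con ℤ.1ℤ) refl (fromℕ k)

  -- With `L` for `x` and `η` for `y`, this replaces the factor `1# / η` of the gradient mapping by
  -- `L`, so that no inverse is left for the ring solver.
  ⁻¹-unique : ∀ {x y} → x * y ≈ 1# → 1# / y ≈ x
  ⁻¹-unique {x} {y} xy≈1 = begin-equality
    1# * y ⁻¹        ≈⟨ *-congʳ xy≈1 ⟨
    x * y * y ⁻¹     ≈⟨ *-assoc _ _ _ ⟩
    x * (y * y ⁻¹)   ≈⟨ *-congˡ (*-inverseʳ y≉0) ⟩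
    x * 1#           ≈⟨ *-identityʳ x ⟩
    x                ∎
    where
    y≉0 : y ≉ 0#
    y≉0 y≈0 = 1≉0 (trans (sym xy≈1) (trans (*-congˡ y≈0) (zeroʳ x)))

  -- Projected gradient steps and their decrease.

  Π∈cube : ∀ {n} (y : Point n) → InCube (Π y)
  -- `Π y i` unfolds to the point of the interval chosen by `nearest (y i)`, so facts about one
  -- coordinate apply directly.
  Π∈cube y i = proj₁ (proj₂ (nearest (y i)))

  iterates∈cube : ∀ {n} η (p : MultilinearPolynomial n) {x₀} → InCube x₀ → ∀ t → InCube (iterates η p x₀ t)
  iterates∈cube η p x₀∈cube zero    = x₀∈cube
  iterates∈cube η p x₀∈cube (suc t) = Π∈cube _

  iterates-step : ∀ {n L η} (p : MultilinearPolynomial n) → L * η ≈ 1# → ∀ x₀ t i →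
                  iterates η p x₀ (suc t) i ≈
                  iterates η p x₀ t i - η * gradientMapping η p (iterates η p x₀ t) i
  iterates-step {L = L} {η} p Lη≈1 x₀ t i = begin-equality
    s                            ≈⟨ solve 2 (λ x s → s := x :- con ℤ.1ℤ :* (x :- s)) refl x s ⟩
    x - 1# * (x - s)             ≈⟨ +-congˡ (-‿cong (*-congʳ η/η≈1)) ⟨
    x - η * (1# / η) * (x - s)   ≈⟨ +-congˡ (-‿cong (*-assoc _ _ _)) ⟩
    x - η * ((1# / η) * (x - s)) ∎
    where
    x s : ℝ
    x = iterates η p x₀ t i
    s = iterates η p x₀ (suc t) i

    η/η≈1 : η * (1# / η) ≈ 1#
    η/η≈1 = trans (*-congˡ (⁻¹-unique Lη≈1)) (trans (*-comm _ _) Lη≈1)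

  -- `L` is the smoothness constant and the reciprocal of the step size, known only through these
  -- equations; for the objective it is `fromℕ (n * m)`.
  module _ {n} {M L η : ℝ} (p : MultilinearPolynomial n) (bound : Bounded M p)
           (0≤L : 0# ≤ L) (L≈nM : L ≈ fromℕ n * M) (Lη≈1 : L * η ≈ 1#) where

    private
      G : Point n → Point n
      G = gradientMapping η p

      step : Point n → Point n
      step x = Π (x ⊖ᵥ η ⊛ ∇ p x)

    -- The variational inequality of the projection, tested at the point x of the cube.
    projection-descent : ∀ x → InCube x → ∀ i →
                         ∇ p x i * (step x i - x i) ≤ - L * ((step x i - x i) * (step x i - x i))
    projection-descent x x∈cube i = difference-nonneg (*-nonneg 0≤L variational) $ begin-equality
      L * ((x i - s) * (s - (x i - η * g)))
        ≈⟨ solve 5 (λ L η x s g → L :* ((x :- s) :* (s :- (x :- η :* g))) :=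
             (:- L) :* ((s :- x) :* (s :- x)) :- (L :* η) :* (g :* (s :- x))) refl L η (x i) s g ⟩
      - L * ((s - x i) * (s - x i)) - L * η * (g * (s - x i))
        ≈⟨ +-congˡ (-‿cong (trans (*-congʳ Lη≈1) (*-identityˡ _))) ⟩
      - L * ((s - x i) * (s - x i)) - g * (s - x i)
        ∎
      where
      s g : ℝ
      s = step x i
      g = ∇ p x i
      variational : 0# ≤ (x i - s) * (s - (x i - η * g))
      variational = proj₂ (proj₂ (nearest (x i - η * g))) (proj₁ (x∈cube i)) (proj₂ (x∈cube i))

    ‖G‖² : ∀ x → ‖ G x ‖₂ * ‖ G x ‖₂ ≈ L * L * ∑² (step x ⊖ᵥ x)
    ‖G‖² x = begin-equality
      ‖ G x ‖₂ * ‖ G x ‖₂              ≈⟨ ‖‖₂² (G x) ⟩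
      ∑² (G x)                         ≈⟨ sum-cong-≋ square ⟩
      sum (λ i → L * L * (d i * d i))  ≈⟨ *-distribˡ-sum (L * L) (λ i → d i * d i) ⟨
      L * L * ∑² d                     ∎
      where
      d : Point n
      d = step x ⊖ᵥ x
      square : ∀ i → G x i * G x i ≈ L * L * (d i * d i)
      square i = trans (*-cong (*-congʳ (⁻¹-unique Lη≈1)) (*-congʳ (⁻¹-unique Lη≈1))) $
        solve 3 (λ L x s → (L :* (x :- s)) :* (L :* (x :- s)) := L :* L :* ((s :- x) :* (s :- x)))
          refl L (x i) (step x i)

    -- Smoothness bounds twice the change of `p` by `2S + LD`, and `projection-descent` summed over
    -- the coordinates gives `S ≤ -LD`, so `p` drops by at least `LD/2`. Scaling by `L + L` turns
    -- this drop into `L * L * D`, the squared norm of `G x`.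
    sufficient-decrease : ∀ x → InCube x →
                          ‖ G x ‖₂ * ‖ G x ‖₂ + (L + L) * eval p (step x) ≤ (L + L) * eval p x
    sufficient-decrease x x∈cube = ≤-trans (≤-reflexive (+-congʳ (‖G‖² x))) $
      difference-nonneg (*-nonneg 0≤L (+-nonneg (x≤y⇒0≤y-x smooth) (+-nonneg 0≤z 0≤z))) $
      solve 5 (λ L D P⁺ P S →
        L :* ((L :* D :- (((P⁺ :- P) :- S) :+ ((P⁺ :- P) :- S))) :+ (((:- L) :* D :- S) :+ ((:- L) :* D :- S))) :=
        (L :+ L) :* P :- (L :* L :* D :+ (L :+ L) :* P⁺)) refl L D (eval p (step x)) (eval p x) S
      where
      d : Point n
      d = step x ⊖ᵥ x
      D S : ℝ
      D = ∑² d
      S = sum λ i → ∇ p x i * d i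

      smooth : linearisationError p x (step x) + linearisationError p x (step x) ≤ L * D
      smooth = begin
        _                  ≤⟨ linearisationError-≤ p bound x (step x) x∈cube (Π∈cube _) ⟩
        M * (fromℕ n * D)  ≈⟨ solve 3 (λ M k D → M :* (k :* D) := k :* M :* D) refl M (fromℕ n) D ⟩
        fromℕ n * M * D    ≈⟨ *-congʳ L≈nM ⟨
        L * D              ∎

      0≤z : 0# ≤ - L * D - S
      0≤z = x≤y⇒0≤y-x $ begin
        S                              ≤⟨ sum-mono-≤ _ _ (projection-descent x x∈cube) ⟩
        sum (λ i → - L * (d i * d i))  ≈⟨ *-distribˡ-sum (- L) (λ i → d i * d i) ⟨
        - L * D                        ∎

    -- Counting the steps before a critical point.

    module _ {x₀ : Point n} (x₀∈cube : InCube x₀) {ε} (0<ε : 0# < ε) where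

      private
        x : ℕ → Point n
        x = iterates η p x₀

        -- `Decreased k` is the telescoped decrease over `k` steps with `‖G‖ ≥ ε`. In both
        -- predicates the division by `ε * ε` is cleared.
        Decreased CriticalPoint : ℕ → Set
        Decreased k = fromℕ k * (ε * ε) + (L + L) * eval p (x k) ≤ (L + L) * eval p x₀
        CriticalPoint t = fromℕ t * (ε * ε) ≤ fromℕ 4 * (L * M) × ‖ G (x t) ‖₂ < ε

        -- Two points of the cube have values at most `2M` apart, and the scale `L + L` makes this
        -- `4LM`.
        decreased⇒≤ : ∀ k → Decreased k → fromℕ k * (ε * ε) ≤ fromℕ 4 * (L * M)
        decreased⇒≤ k dec = difference-nonneg
          (+-nonneg (x≤y⇒0≤y-x dec)
            (*-nonneg (+-nonneg 0≤L 0≤L)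
              (+-nonneg (x≤y⇒0≤y-x (proj₂ (bound x₀ x₀∈cube)))
                        (x≤y⇒0≤y-x (proj₁ (bound (x k) (iterates∈cube η p x₀∈cube k))))))) $
          solve 5 (λ K L M P₀ P →
            ((L :+ L) :* P₀ :- (K :+ (L :+ L) :* P)) :+ (L :+ L) :* ((M :- P₀) :+ (P :- (:- M))) :=
            (con ℤ.1ℤ :+ (con ℤ.1ℤ :+ (con ℤ.1ℤ :+ (con ℤ.1ℤ :+ con ℤ.0ℤ)))) :* (L :* M) :- K) refl
            (fromℕ k * (ε * ε)) L M (eval p x₀) (eval p (x k))

        search : ∀ k → ∃ CriticalPoint ⊎ Decreased k
        search zero = inj₂ $ ≤-reflexive $ trans (+-congʳ (zeroˡ _)) (+-identityˡ _)
        search (suc k) with search k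
        ... | inj₁ found = inj₁ found
        ... | inj₂ dec with ε ≤? ‖ G (x k) ‖₂
        -- No earlier iterate was critical, so the accumulated decrease already bounds the index
        -- `k`.
        ...   | no  ε≰G = inj₁ (k , decreased⇒≤ k dec , ≰⇒> ε≰G)
        ...   | yes ε≤G = inj₂ $ begin
          fromℕ (suc k) * (ε * ε) + (L + L) * P⁺
            ≈⟨ solve 3 (λ k e q → (con ℤ.1ℤ :+ k) :* e :+ q := k :* e :+ (e :+ q)) refl (fromℕ k) (ε * ε) ((L + L) * P⁺) ⟩
          fromℕ k * (ε * ε) + (ε * ε + (L + L) * P⁺)
            ≤⟨ +-monoʳ-≤ _ (+-mono-≤ (*-mono-≤ (proj₁ 0<ε) ε≤G (proj₁ 0<ε) ε≤G) ≤-refl) ⟩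
          fromℕ k * (ε * ε) + (‖ G (x k) ‖₂ * ‖ G (x k) ‖₂ + (L + L) * P⁺)
            ≤⟨ +-monoʳ-≤ _ (sufficient-decrease (x k) (iterates∈cube η p x₀∈cube k)) ⟩
          fromℕ k * (ε * ε) + (L + L) * eval p (x k)
            ≤⟨ dec ⟩
          (L + L) * eval p x₀ ∎
          where P⁺ = eval p (x (suc k))

      ε²≉0 : ε * ε ≉ 0#
      ε²≉0 ε²≈0 = proj₂ 0<ε (sym (x*x≈0⇒x≈0 ε²≈0))

      0<ε² : 0# < ε * ε
      0<ε² = 0≤x*x ε , ε²≉0 ∘ sym

      ≤-divide : ∀ {a b} → a * (ε * ε) ≤ b → a ≤ b / (ε * ε)
      ≤-divide {a} {b} aε²≤b = begin
        a                            ≈⟨ *-identityʳ a ⟨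
        a * 1#                       ≈⟨ *-congˡ (*-inverseʳ ε²≉0) ⟨
        a * (ε * ε * (ε * ε) ⁻¹)     ≈⟨ *-assoc _ _ _ ⟨
        a * (ε * ε) * (ε * ε) ⁻¹     ≈⟨ *-comm _ _ ⟩
        (ε * ε) ⁻¹ * (a * (ε * ε))   ≤⟨ *-monoʳ-≤ (⁻¹-nonneg 0<ε²) aε²≤b ⟩
        (ε * ε) ⁻¹ * b               ≈⟨ *-comm _ _ ⟩
        b / (ε * ε)                  ∎

      reaches-critical-point : ∃ λ t → fromℕ t ≤ fromℕ 4 * (L * M / (ε * ε)) × ‖ G (x t) ‖₂ < ε
      reaches-critical-point with archimedean (fromℕ 4 * (L * M) / (ε * ε))
      -- `K` only makes the search finite; the bound on `t` comes from the search itself. One step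
      -- beyond `K` is needed, since a failed search then yields `K + 1 ≤ K`.
      ... | K , B≤K with search (suc K)
      ...   | inj₁ (t , t≤B , G<ε) = t , ≤-trans (≤-divide t≤B) (≤-reflexive (*-assoc _ _ _)) , G<ε
      ...   | inj₂ dec = ⊥-elim $ 1≉0 $ antisym
                (1+k≤k⇒1≤0 K (≤-trans (≤-divide (decreased⇒≤ (suc K) dec)) B≤K)) 0≤1

  fromℕ-n*m² : ∀ n m → fromℕ (n ℕ.* m ℕ.^ 2) ≈ fromℕ (n ℕ.* m) * fromℕ m
  fromℕ-n*m² n m = trans
    (reflexive (≡.cong fromℕ (≡.trans (≡.cong (λ k → n ℕ.* (m ℕ.* k)) (ℕ.*-identityʳ m)) (≡.sym (ℕ.*-assoc n m m)))))
    (×1-homo-* (n ℕ.* m) m)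

theorem8 :
    ∃ λ (C : ℕ) →
    (R : Reals) → let open Reals R in let open ProjectedGradientDescent R in
    (n m : ℕ) .{{_ : NonZero n}} .{{_ : NonZero m}} (f : Formula n m) →
    let F = objective f
        η = 1# / fromℕ (n ℕ.* m)
        G = gradientMapping η F
    in
    (∀ x → InCube x → - fromℕ m ≤ eval F x × eval F x ≤ fromℕ m) ×
    (∀ x₀ → InCube x₀ →
      let x = iterates η F x₀ in
      (∀ t → _≋_ setoid (x (suc t)) (x t ⊖ᵥ η ⊛ G (x t))) ×
      (∀ ε → 0# < ε →
        ∃ λ t → fromℕ t ≤ fromℕ C * (fromℕ (n ℕ.* m ℕ.^ 2) / (ε * ε)) × ‖ G (x t) ‖₂ < ε))
-- A decrease of at least `ηε²/2` per step against a total variation of `2m` allows `4nm²/ε²` steps,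
-- whence the constant `4`.
theorem8 = 4 , λ R n m f →
  let open Reals R
      open RealProperties R
      open ProjectedGradientDescent R
      open Convergence R
      open SemiringMult semiring using (×1-homo-*)

      F = objective f
      L = fromℕ (n ℕ.* m)
      η = 1# / L
      bound = objective-bounded f
      0≤L = 0≤fromℕ (n ℕ.* m)
      L≈nm = ×1-homo-* n m
      Lη≈1 = trans (*-congˡ (*-identityˡ _)) (*-inverseʳ (fromℕ≉0 (n ℕ.* m) {{ℕ.m*n≢0 n m}}))
  in
  bound , λ x₀ x₀∈cube →
    iterates-step F Lη≈1 x₀ ,
    λ ε 0<ε →
      let t , t≤B , G<ε = reaches-critical-point F bound 0≤L L≈nm Lη≈1 x₀∈cube 0<ε
      in t , ≤-trans t≤B (≤-reflexive (*-congˡ (*-congʳ (sym (fromℕ-n*m² n m))))) , G<ε
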